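{- $\le_T^{O}\ \not\subseteq\ \le_T^{U}$, i.e., there exist sets $X,Y$ with $X\le_T^{O}Y$ and $X\not\le_T^{U}Y$.
   Context: An NPTM is a nondeterministic oracle Turing machine $N$ each of whose computation paths ends in one of three outcomes $\mathbf{acc}$, $\mathbf{rej}$, $\mathbf{?}$, such that there is a polynomial $p$ with: for every oracle $D$ and every input $x$, every computation path of $N^D(x)$ has length at most $p(|x|)$. For an oracle $D$ and input $x$, let $out_{N^D}(x)$ be the set of outcomes occurring on some path of $N^D(x)$; $L(N^D)=\{x:\mathbf{acc}\in out_{N^D}(x)\}$. $N^D(x)$ is underproductive if $\{\mathbf{acc},\mathbf{rej}\}\not\subseteq out_{N^D}(x)$, and overproductive if $out_{N^D}(x)\neq\{\mathbf{?}\}$; $N^D$ is underproductive (overproductive) if $N^D(x)$ is so for every $x$. $N$ is robustly underproductive (overproductive) if $N^D$ is underproductive (overproductive) for every oracle $D$. $A\le_T^{SN}B$ if there is an NPTM $N$ with $N^B$ both overproductive and underproductive and $A=L(N^B)$. $A\le_T^{U}B$ if $A\le_T^{SN}B$ via an $N$ that is robustly underproductive. $A\le_T^{O}B$ if $A\le_T^{SN}B$ via an $N$ that is robustly overproductive. A reducibility is identified with the set of pairs $(A,B)$ it relates. -}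

module Defs where

open import Data.Nat using (ℕ; zero; suc; _+_; _*_; _^_; _≤_)
open import Data.Fin using (Fin)
open import Data.Bool using (Bool; true; false; if_then_else_)
open import Data.List using (List; []; _∷_; length; map; _++_; [_])
open import Data.Maybe using (Maybe; just; nothing)
open import Data.Product using (Σ; ∃; _×_; _,_)
open import Data.Sum using (_⊎_)
open import Data.Empty using (⊥)
open import Relation.Nullary using (¬_)
open import Relation.Binary.PropositionalEquality using (_≡_; _≢_)
open import Data.List.Membership.Propositional using (_∈_)
open import Function.Bundles using (_⇔_)

Str : Set
Str = List Bool

Lang : Set
Lang = Str → Bool

data Outcome : Set where
  acc rej que : Outcome

data Move : Set where
  L S R : Move

-- Nondeterministic oracle Turing machines.
-- One two-way-infinite-to-the-right work tape (initially holding the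
-- input), plus a write-only query tape.  Tape alphabet
-- Fin (3 + Γ): 0 = blank, 1 = bit false, 2 = bit true, others extra.
-- A transition reads (state, scanned symbol) and nondeterministically
-- chooses (new state, written symbol, head move, optional bit appended
-- to the query tape).  In the query state qQ the next state is qY if the
-- query string is in the oracle and qN otherwise; the query tape is then
-- erased.  A configuration without successor ends the path, and the
-- outcome of the path is the label  res  of its final state.

record NOTM : Set where
  field
    Q     : ℕ
    Γ     : ℕ
    start : Fin Q
    qQ    : Fin Q
    qY    : Fin Q
    qN    : Fin Q
    δ     : Fin Q → Fin (3 + Γ) → List (Fin Q × Fin (3 + Γ) × Move × Maybe Bool)
    res   : Fin Q → Outcome

module _ (N : NOTM) where
  open NOTM N

  Sym : Set
  Sym = Fin (3 + Γ)

  blank : Sym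
  blank = Fin.zero

  bitSym : Bool → Sym
  bitSym false = Fin.suc Fin.zero
  bitSym true  = Fin.suc (Fin.suc Fin.zero)

  -- left part (reversed, nearest cell first) and right part (starting
  -- with the scanned cell; empty means scanning a blank)
  record Config : Set where
    constructor cfg
    field
      state : Fin Q
      left  : List Sym
      right : List Sym
      query : Str

  scanned : List Sym → Sym
  scanned []      = blank
  scanned (a ∷ _) = a

  rest : List Sym → List Sym
  rest []       = []
  rest (_ ∷ as) = as

  moveHead : List Sym → List Sym → Sym → Move → List Sym × List Sym
  moveHead l r w S = l , (w ∷ rest r)
  moveHead l r w R = (w ∷ l) , rest r
  moveHead [] r w L = [] , (w ∷ rest r)
  moveHead (a ∷ l) r w L = l , (a ∷ w ∷ rest r)

  appendQ : Str → Maybe Bool → Str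
  appendQ q nothing  = q
  appendQ q (just b) = q ++ [ b ]

  data Step (D : Lang) : Config → Config → Set where
    query-yes : ∀ {l r q} → D q ≡ true →
      Step D (cfg qQ l r q) (cfg qY l r [])
    query-no  : ∀ {l r q} → D q ≡ false →
      Step D (cfg qQ l r q) (cfg qN l r [])
    move : ∀ {s l r q s' w m a} → s ≢ qQ →
      (s' , w , m , a) ∈ δ s (scanned r) →
      Step D (cfg s l r q)
             (cfg s' (Data.Product.proj₁ (moveHead l r w m))
                     (Data.Product.proj₂ (moveHead l r w m)) (appendQ q a))

  data Steps (D : Lang) : Config → ℕ → Config → Set where
    done : ∀ {c} → Steps D c 0 c
    step : ∀ {c c' c'' t} → Step D c c' → Steps D c' t c'' → Steps D c (suc t) c''

  initial : Str → Config
  initial x = cfg start [] (map bitSym x) []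

  Halted : Lang → Config → Set
  Halted D c = ∀ c' → ¬ Step D c c'

  Produces : Lang → Str → Outcome → Set
  Produces D x o = Σ ℕ λ t → Σ Config λ c →
    Steps D (initial x) t c × Halted D c × res (Config.state c) ≡ o

  Decides : Lang → Lang → Set
  Decides D A = ∀ x → (A x ≡ true) ⇔ Produces D x acc

  Underproductive : Lang → Set
  Underproductive D = ∀ x → ¬ (Produces D x acc × Produces D x rej)

  Overproductive : Lang → Set
  Overproductive D = ∀ x → ¬ (∀ o → Produces D x o ⇔ (o ≡ que))

  RobustlyUnderproductive : Set
  RobustlyUnderproductive = ∀ D → Underproductive D

  RobustlyOverproductive : Set
  RobustlyOverproductive = ∀ D → Overproductive D

  PolyTime : Set
  PolyTime = Σ ℕ λ c → Σ ℕ λ k → ∀ D x t c' →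
    Steps D (initial x) t c' → t ≤ c * length x ^ k + c

record NPTM : Set where
  field
    machine : NOTM
    poly    : PolyTime machine

open NPTM public

SNVia : NPTM → Lang → Lang → Set
SNVia N A B = Overproductive (machine N) B × Underproductive (machine N) B
            × Decides (machine N) B A

_≤SN_ : Lang → Lang → Set
A ≤SN B = Σ NPTM λ N → SNVia N A B

_≤U_ : Lang → Lang → Set
A ≤U B = Σ NPTM λ N → RobustlyUnderproductive (machine N) × SNVia N A B

_≤O_ : Lang → Lang → Set
A ≤O B = Σ NPTM λ N → RobustlyOverproductive (machine N) × SNVia N A B

{-# OPTIONS --safe #-}

-- Reading an oracle D at every length m as a map f from strings of length m + 1 to strings of
-- length m, together with a label for every string of length m + 1, consider the search for a
-- collision x ≠ x′, f x = f x′.  A machine that guesses x and x′, compares f x with f x′ bit by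
-- bit and outputs the label of x is robustly overproductive by the pigeonhole principle, and
-- it is underproductive as soon as all collisions carry the same label.
--
-- The oracle Y is built in stages, one for every clocked machine N, so that all collisions of
-- every length carry the same label; X is that label.  At the stage of N all of f but a finite
-- injective part is constant, with label b on the rest: every collision is then labelled b.
-- As long as N has an accepting path for b = true, the strings it asks about are added to the
-- injective part; if this never fails during more rounds than N has time, b is set to false.
-- If N were robustly underproductive, a rejecting path for the final oracle would conflict
-- with the accepting path of each round, at a query not asked in the earlier rounds: more
-- queries than its running time.

module Submission where

open import Defs
open import Data.Bool using (Bool; true; false; not; if_then_else_; _∨_; _xor_)
import Data.Bool.Properties as Bool
open import Data.Empty using (⊥-elim)
open import Data.Fin using (Fin; zero; suc; toℕ; fromℕ<; combine; remQuot; splitAt; _↑ʳ_; #_;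
  finToFun; funToFin)
open import Data.Fin.Properties using (2↔Bool; pigeonhole; combine-remQuot;
  remQuot-combine; finToFun-funToFin; toℕ-fromℕ<)
import Data.Fin.Properties as Fin
open import Data.List using (List; []; _∷_; [_]; _++_; _ʳ++_; length; map; replicate; take;
  drop; filter; reverse)
open import Data.List.Membership.Propositional using (_∈_; find; lose)
open import Data.List.Membership.Propositional.Properties using (∈-map⁺; ∈-map⁻)
open import Data.List.Properties using (length-++; length-map; length-replicate; length-filter;
  length-ʳ++; length-reverse; ++-assoc; ++-identityʳ; ++-ʳ++; ʳ++-ʳ++; map-++; map-cong; map-id;
  map-∘; map-ʳ++; reverse-map; reverse-injective; reverse-involutive; ∷-injective; ≡-dec)
open import Data.List.Relation.Unary.Any using (Any; here; there; any?)
open import Data.Maybe using (Maybe; just; nothing)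
open import Data.Nat using (ℕ; zero; suc; pred; _+_; _*_; _∸_; _^_; _≤_; _<_; z≤n;
  s≤s; ⌊_/2⌋; _≡ᵇ_)
open import Data.Nat.Properties
open import Data.Nat.Tactic.RingSolver using (solve-∀)
open import Data.Product using (Σ; ∃; ∃₂; _×_; _,_; proj₁; proj₂)
open import Data.Sum using (_⊎_; inj₁; inj₂; [_,_]′)
open import Data.Vec using (Vec; []; _∷_; lookup; tabulate; toList; fromList)
open import Data.Vec.Properties using (lookup∘tabulate)
open import Function using (_∘_)
open import Function.Bundles using (mk⇔; module Equivalence; module Inverse)
open import Relation.Binary.Definitions using (tri<; tri≈; tri>)
open import Relation.Binary.PropositionalEquality using (_≡_; _≢_; refl; sym; trans;
  cong; cong₂; subst; module ≡-Reasoning)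
open import Relation.Nullary using (¬_; Dec; yes; no; contradiction)
open import Relation.Nullary.Decidable using (map′; _⊎-dec_; _×-dec_; ¬?; decidable-stable)
open import Relation.Unary using (Decidable)

-- Runs and paths

verdict : Bool → Outcome
verdict b = if b then acc else rej

_≟ᵒ_ : (o o' : Outcome) → Dec (o ≡ o')
acc ≟ᵒ acc = yes refl
acc ≟ᵒ rej = no λ ()
acc ≟ᵒ que = no λ ()
rej ≟ᵒ acc = no λ ()
rej ≟ᵒ rej = yes refl
rej ≟ᵒ que = no λ ()
que ≟ᵒ acc = no λ ()
que ≟ᵒ rej = no λ ()
que ≟ᵒ que = yes refl

module Runs (N : NOTM) where
  open NOTM N

  Conf : Set
  Conf = Config N

  Reaches : Lang → Conf → Outcome → Set
  Reaches D c o = Σ ℕ λ t → Σ Conf λ c' →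
    Steps N D c t c' × Halted N D c' × res (Config.state c') ≡ o

  Bounded : Lang → Conf → ℕ → Set
  Bounded D c b = ∀ t c' → Steps N D c t c' → t ≤ b

  apply : List (Sym N) → List (Sym N) → Str → Fin Q × Sym N × Move × Maybe Bool → Conf
  apply l r q (s , w , m , a) =
    cfg s (proj₁ (moveHead N l r w m)) (proj₂ (moveHead N l r w m)) (appendQ N q a)

  answer : Bool → Fin Q
  answer b = if b then qY else qN

  next : Lang → Conf → List Conf
  next D (cfg s l r q) with s Fin.≟ qQ
  ... | yes _ = [ cfg (answer (D q)) l r [] ]
  ... | no  _ = map (apply l r q) (δ s (scanned N r))

  query-step : ∀ {D l r q} → Step N D (cfg qQ l r q) (cfg (answer (D q)) l r [])
  query-step {D} {q = q} with D q in eq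
  ... | true  = query-yes eq
  ... | false = query-no eq

  next-complete : ∀ {D c c'} → Step N D c c' → c' ∈ next D c
  next-complete (query-yes {q = q} eq) with qQ Fin.≟ qQ
  ... | yes _ rewrite eq = here refl
  ... | no ¬p = contradiction refl ¬p
  next-complete (query-no {q = q} eq) with qQ Fin.≟ qQ
  ... | yes _ rewrite eq = here refl
  ... | no ¬p = contradiction refl ¬p
  next-complete (move {s = s} {l} {r} {q} s≢ e) with s Fin.≟ qQ
  ... | yes p = contradiction p s≢
  ... | no _ = ∈-map⁺ (apply l r q) e

  next-sound : ∀ {D c c'} → c' ∈ next D c → Step N D c c'
  next-sound {D} {cfg s l r q} i with s Fin.≟ qQ
  next-sound (here refl) | yes refl = query-step
  next-sound {D} {cfg s l r q} i | no ¬p with ∈-map⁻ (apply l r q) i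
  ... | (_ , _ , _ , _) , j , refl = move ¬p j

  next-step : ∀ {D c c' cs} → next D c ≡ c' ∷ cs → Step N D c c'
  next-step eq = next-sound (subst (_ ∈_) (sym eq) (here refl))

  halted? : ∀ D c → Dec (Halted N D c)
  halted? D c with next D c in eq
  ... | []     = yes λ c' s → contradiction (subst (c' ∈_) eq (next-complete s)) λ ()
  ... | c' ∷ _ = no λ h → h c' (next-step eq)

  asked : ∀ {D c t c'} → Steps N D c t c' → List Str
  asked done = []
  asked (step (query-yes {q = q} _) ss) = q ∷ asked ss
  asked (step (query-no {q = q} _) ss)  = q ∷ asked ss
  asked (step (move _ _) ss) = asked ss

  length-asked : ∀ {D c t c'} (ss : Steps N D c t c') → length (asked ss) ≤ t
  length-asked done = z≤n
  length-asked (step (query-yes _) ss) = s≤s (length-asked ss)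
  length-asked (step (query-no _) ss)  = s≤s (length-asked ss)
  length-asked (step (move _ _) ss)    = m≤n⇒m≤1+n (length-asked ss)

  length-appendQ : ∀ q a → length (appendQ N q a) ≤ suc (length q)
  length-appendQ q nothing  = n≤1+n _
  length-appendQ q (just b) = ≤-reflexive (trans (length-++ q) (+-comm (length q) 1))

  -- The query tape grows by at most one bit per step and is erased by every query. With the growth
  -- of `ν` this keeps the runs of a stage away from the lengths changed later.
  asked-short : ∀ {D c t c' q} (ss : Steps N D c t c') → q ∈ asked ss →
    length q ≤ length (Config.query c) + t
  asked-short (step (query-yes _) ss) (here refl) = m≤m+n _ _
  asked-short (step (query-yes _) ss) (there i) =
    ≤-trans (asked-short ss i) (≤-trans (n≤1+n _) (m≤n+m _ _))
  asked-short (step (query-no _) ss) (here refl) = m≤m+n _ _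
  asked-short (step (query-no _) ss) (there i) =
    ≤-trans (asked-short ss i) (≤-trans (n≤1+n _) (m≤n+m _ _))
  asked-short {t = suc t} {q = q'} (step (move {q = q} {a = a} _ _) ss) i =
    ≤-trans (asked-short ss i)
      (≤-trans (+-monoˡ-≤ t (length-appendQ q a)) (≤-reflexive (sym (+-suc (length q) t))))

  -- The oracle enters a run only through the answers in its query steps, so agreement on the
  -- strings in `asked` suffices.
  reroute : ∀ {D D' c t c'} (ss : Steps N D c t c') →
    (∀ {q} → q ∈ asked ss → D q ≡ D' q) → Steps N D' c t c'
  reroute done agree = done
  reroute (step (query-yes eq) ss) agree =
    step (query-yes (trans (sym (agree (here refl))) eq)) (reroute ss λ i → agree (there i))
  reroute (step (query-no eq) ss) agree =
    step (query-no (trans (sym (agree (here refl))) eq)) (reroute ss λ i → agree (there i))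
  reroute (step (move p i) ss) agree = step (move p i) (reroute ss agree)

  -- The query state has a successor under every oracle, so halting depends on the configuration
  -- alone.
  halted-any : ∀ {D D' c} → Halted N D c → Halted N D' c
  halted-any h _ (query-yes _) = h _ query-step
  halted-any h _ (query-no _)  = h _ query-step
  halted-any h _ (move p i)    = h _ (move p i)

  record Path (D : Lang) (c : Conf) (b : ℕ) (o : Outcome) : Set where
    constructor path
    field
      {time}  : ℕ
      {final} : Conf
      within  : time ≤ b
      steps   : Steps N D c time final
      halts   : Halted N D final
      outcome : res (Config.state final) ≡ o

    queries : List Str
    queries = asked steps

  open Path public

  reaches-path : ∀ {D c b o} → Bounded D c b → Reaches D c o → Path D c b o
  reaches-path bd (t , c' , ss , h , r) = path (bd t c' ss) ss h r

  -- The time bound and the finite list `next` of successors make this decidable. The oracle of each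
  -- stage is defined by cases on the answer.
  search : ∀ D b c o → Dec (Path D c b o)
  search D zero c o = map′
    (λ (h , r) → path z≤n done h r)
    (λ { (path {zero} z≤n done h r) → h , r })
    (halted? D c ×-dec (res (Config.state c) ≟ᵒ o))
  search D (suc b) c o = map′ from to
    ((halted? D c ×-dec (res (Config.state c) ≟ᵒ o))
      ⊎-dec any? (λ c' → search D b c' o) (next D c))
    where
    from : (Halted N D c × res (Config.state c) ≡ o) ⊎ Any (λ c' → Path D c' b o) (next D c) →
      Path D c (suc b) o
    from (inj₁ (h , r)) = path z≤n done h r
    from (inj₂ a) with find a
    ... | c' , i , path t≤ ss h r = path (s≤s t≤) (step (next-sound i) ss) h r
    to : Path D c (suc b) o →
      (Halted N D c × res (Config.state c) ≡ o) ⊎ Any (λ c' → Path D c' b o) (next D c)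
    to (path z≤n done h r) = inj₁ (h , r)
    to (path (s≤s t≤) (step s ss) h r) = inj₂ (lose (next-complete s) (path t≤ ss h r))

  -- Always taking the first successor has to end within the bound. This supplies a path with
  -- outcome `que` once the other two are excluded.
  some-outcome : ∀ {D} b c → Bounded D c b → ∃ (Reaches D c)
  some-outcome {D} b c bd with next D c in eq
  ... | [] = _ , 0 , c , done ,
    (λ c' s → contradiction (subst (c' ∈_) eq (next-complete s)) λ ()) , refl
  some-outcome zero c bd | c' ∷ _ with bd 1 c' (step (next-step eq) done)
  ... | ()
  some-outcome (suc b) c bd | c' ∷ _
    with some-outcome b c' (λ t c'' ss → ≤-pred (bd (suc t) c'' (step (next-step eq) ss)))
  ... | o , t , c'' , ss , h , r = o , suc t , c'' , step (next-step eq) ss , h , r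

-- Enumerating clocked machines

-- A surjection from the natural numbers with a chosen section; repetitions are harmless. Such an
-- `A` is inhabited, whence finite types appear as `Fin (suc n)`.
record Countable (A : Set) : Set where
  constructor countable
  field
    enum       : ℕ → A
    index      : A → ℕ
    enum-index : ∀ a → enum (index a) ≡ a

open Countable

-- A walk along the antidiagonals: the sum of the entries is constant until the second one is 0,
-- then the next antidiagonal begins.
unpair : ℕ → ℕ × ℕ
unpair zero    = 0 , 0
unpair (suc n) with unpair n
... | a , zero  = 0 , suc a
... | a , suc b = suc a , b

unpair-surjective : ∀ s a b → a + b ≡ s → ∃ λ n → unpair n ≡ (a , b)
unpair-surjective zero zero zero refl = 0 , refl
unpair-surjective (suc s) zero (suc .s) refl with unpair-surjective s s 0 (+-identityʳ s)
... | n , eq = suc n , lemma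
  where
  lemma : unpair (suc n) ≡ (0 , suc s)
  lemma rewrite eq = refl
unpair-surjective s (suc a) b refl with unpair-surjective s a (suc b) (+-suc a b)
... | n , eq = suc n , lemma
  where
  lemma : unpair (suc n) ≡ (suc a , b)
  lemma rewrite eq = refl

ℕ-countable : Countable ℕ
ℕ-countable = countable (λ n → n) (λ n → n) (λ _ → refl)

Σ-countable : ∀ {A : Set} {B : A → Set} → Countable A → (∀ a → Countable (B a)) → Countable (Σ A B)
Σ-countable {A} {B} ca cb = countable enumΣ indexΣ enum-indexΣ
  where
  decode : ℕ × ℕ → Σ A B
  decode (m , n) = enum ca m , enum (cb (enum ca m)) n
  enumΣ : ℕ → Σ A B
  enumΣ n = decode (unpair n)
  reach : ∀ a b → ∃ λ n → unpair n ≡ (index ca a , index (cb a) b)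
  reach a b = unpair-surjective _ _ _ refl
  indexΣ : Σ A B → ℕ
  indexΣ (a , b) = proj₁ (reach a b)
  enum-indexΣ : ∀ p → enumΣ (indexΣ p) ≡ p
  enum-indexΣ (a , b) rewrite proj₂ (reach a b) | enum-index ca a | enum-index (cb a) b = refl

_×-countable_ : ∀ {A B : Set} → Countable A → Countable B → Countable (A × B)
ca ×-countable cb = Σ-countable ca λ _ → cb

retract : ∀ {A B : Set} (f : A → B) (g : B → A) → (∀ b → f (g b) ≡ b) → Countable A → Countable B
retract f g fg ca = countable (λ n → f (enum ca n)) (λ b → index ca (g b))
  λ b → trans (cong f (enum-index ca (g b))) (fg b)

Fin-countable : ∀ n → Countable (Fin (suc n))
Fin-countable n = countable clamp toℕ clamp-toℕ
  where
  clamp : ∀ {n} → ℕ → Fin (suc n)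
  clamp {zero}  _       = zero
  clamp {suc n} zero    = zero
  clamp {suc n} (suc k) = suc (clamp k)
  clamp-toℕ : ∀ {n} (i : Fin (suc n)) → clamp (toℕ i) ≡ i
  clamp-toℕ {zero}  zero    = refl
  clamp-toℕ {suc n} zero    = refl
  clamp-toℕ {suc n} (suc i) = cong suc (clamp-toℕ i)

Vec-countable : ∀ {A : Set} → Countable A → ∀ n → Countable (Vec A n)
Vec-countable ca zero    = countable (λ _ → []) (λ _ → 0) λ { [] → refl }
Vec-countable ca (suc n) = retract (λ (a , v) → a ∷ v) (λ { (a ∷ v) → a , v })
  (λ { (a ∷ v) → refl }) (ca ×-countable Vec-countable ca n)

List-countable : ∀ {A : Set} → Countable A → Countable (List A)
List-countable ca = retract (λ (_ , v) → toList v) (λ l → _ , fromList l)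
  toList-fromList (Σ-countable ℕ-countable (Vec-countable ca))
  where
  toList-fromList : ∀ {A : Set} (l : List A) → toList (fromList l) ≡ l
  toList-fromList []      = refl
  toList-fromList (a ∷ l) = cong (a ∷_) (toList-fromList l)

Maybe-Bool-countable : Countable (Maybe Bool)
Maybe-Bool-countable = retract f g (λ { nothing → refl ; (just false) → refl ; (just true) → refl })
  (Fin-countable 2)
  where
  f : Fin 3 → Maybe Bool
  f zero             = nothing
  f (suc zero)       = just false
  f (suc (suc zero)) = just true
  g : Maybe Bool → Fin 3
  g nothing      = zero
  g (just false) = suc zero
  g (just true)  = suc (suc zero)

Move-countable : Countable Move
Move-countable = retract f g (λ { L → refl ; S → refl ; R → refl }) (Fin-countable 2)
  where
  f : Fin 3 → Move
  f zero             = L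
  f (suc zero)       = S
  f (suc (suc zero)) = R
  g : Move → Fin 3
  g L = zero
  g S = suc zero
  g R = suc (suc zero)

Outcome-countable : Countable Outcome
Outcome-countable = retract f g (λ { acc → refl ; rej → refl ; que → refl }) (Fin-countable 2)
  where
  f : Fin 3 → Outcome
  f zero             = acc
  f (suc zero)       = rej
  f (suc (suc zero)) = que
  g : Outcome → Fin 3
  g acc = zero
  g rej = suc zero
  g que = suc (suc zero)

Rule : ℕ → ℕ → Set
Rule Q Γ = Fin Q × Fin (3 + Γ) × Move × Maybe Bool

-- The number of states of a code is one more than its first entry.
Code : Set
Code = Σ (ℕ × ℕ) λ (q , Γ) → (Fin (suc q) × Fin (suc q) × Fin (suc q) × Fin (suc q)) ×
  Vec (Vec (List (Rule (suc q) Γ)) (3 + Γ)) (suc q) × Vec Outcome (suc q)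

Code-countable : Countable Code
Code-countable = Σ-countable (ℕ-countable ×-countable ℕ-countable) λ (q , Γ) →
  let st = Fin-countable q in
  (st ×-countable (st ×-countable (st ×-countable st))) ×-countable
  (Vec-countable (Vec-countable (List-countable
      (st ×-countable (Fin-countable (2 + Γ) ×-countable (Move-countable ×-countable Maybe-Bool-countable))))
      (3 + Γ)) (suc q)
    ×-countable Vec-countable Outcome-countable (suc q))

decode : Code → NOTM
decode ((q , Γ) , (start , qQ , qY , qN) , rules , labels) = record
  { Q = suc q ; Γ = Γ ; start = start ; qQ = qQ ; qY = qY ; qN = qN
  ; δ = λ s a → lookup (lookup rules s) a ; res = lookup labels }

-- Machines with pointwise equal transition functions

module Twin (N : NOTM)
  (δ′ : Fin (NOTM.Q N) → Fin (3 + NOTM.Γ N) → List (Rule (NOTM.Q N) (NOTM.Γ N)))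
  (res′ : Fin (NOTM.Q N) → Outcome)
  (δ≡ : ∀ s a → NOTM.δ N s a ≡ δ′ s a) (res≡ : ∀ s → NOTM.res N s ≡ res′ s) where

  open NOTM N

  N′ : NOTM
  N′ = record N { δ = δ′ ; res = res′ }

  twin : Config N → Config N′
  twin (cfg s l r q) = cfg s l r q

  scanned≡ : ∀ r → scanned N r ≡ scanned N′ r
  scanned≡ []      = refl
  scanned≡ (_ ∷ _) = refl

  rest≡ : ∀ r → rest N r ≡ rest N′ r
  rest≡ []      = refl
  rest≡ (_ ∷ _) = refl

  moveHead≡ : ∀ l r w m → moveHead N l r w m ≡ moveHead N′ l r w m
  moveHead≡ l       r w S = cong (λ r′ → l , (w ∷ r′)) (rest≡ r)
  moveHead≡ l       r w R = cong (λ r′ → (w ∷ l) , r′) (rest≡ r)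
  moveHead≡ []      r w L = cong (λ r′ → [] , (w ∷ r′)) (rest≡ r)
  moveHead≡ (a ∷ l) r w L = cong (λ r′ → l , (a ∷ w ∷ r′)) (rest≡ r)

  appendQ≡ : ∀ q a → appendQ N q a ≡ appendQ N′ q a
  appendQ≡ q nothing  = refl
  appendQ≡ q (just _) = refl

  -- A code stores `δ` and `res` as tables, so decoding returns a machine that agrees with the
  -- original one only pointwise; its runs are therefore carried over step by step.
  twin-step : ∀ {D c c'} → Step N D c c' → Step N′ D (twin c) (twin c')
  twin-step (query-yes eq) = query-yes eq
  twin-step (query-no eq)  = query-no eq
  twin-step (move {s} {l} {r} {q} {s'} {w} {m} {a} s≢ i)
    rewrite moveHead≡ l r w m | appendQ≡ q a =
    move s≢ (subst ((s' , w , m , a) ∈_) (trans (δ≡ s _) (cong (δ′ s) (scanned≡ r))) i)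

  twin-steps : ∀ {D c t c'} → Steps N D c t c' → Steps N′ D (twin c) t (twin c')
  twin-steps done        = done
  twin-steps (step s ss) = step (twin-step s) (twin-steps ss)

  twin-initial : ∀ x → twin (initial N x) ≡ initial N′ x
  twin-initial x = cong (λ r → cfg start [] r [])
    (map-cong (λ { false → refl ; true → refl }) x)

module Twins (N : NOTM)
  (δ′ : Fin (NOTM.Q N) → Fin (3 + NOTM.Γ N) → List (Rule (NOTM.Q N) (NOTM.Γ N)))
  (res′ : Fin (NOTM.Q N) → Outcome)
  (δ≡ : ∀ s a → NOTM.δ N s a ≡ δ′ s a) (res≡ : ∀ s → NOTM.res N s ≡ res′ s) where

  open NOTM N

  open Twin N δ′ res′ δ≡ res≡ public
  module Back = Twin N′ δ res (λ s a → sym (δ≡ s a)) (λ s → sym (res≡ s))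

  twin-produces : ∀ {D x o} → Produces N D x o → Produces N′ D x o
  twin-produces {D} {x} (t , c , ss , h , r) =
    t , twin c , subst (λ c₀ → Steps N′ D c₀ t (twin c)) (twin-initial x) (twin-steps ss) ,
    -- A step of the twin from its final configuration would be carried back to a step of `N`.
    (λ c' s → h (Back.twin c') (Back.twin-step s)) , trans (sym (res≡ (Config.state c))) r

module Tabulate (N : NOTM) where
  open NOTM N

  rules : Vec (Vec (List (Rule Q Γ)) (3 + Γ)) Q
  rules = tabulate λ s → tabulate (δ s)

  labels : Vec Outcome Q
  labels = tabulate res

  rules-lookup : ∀ s a → δ s a ≡ lookup (lookup rules s) a
  rules-lookup s a = sym (trans (cong (λ v → lookup v a) (lookup∘tabulate (λ s → tabulate (δ s)) s))
    (lookup∘tabulate (δ s) a))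

  open Twins N (λ s a → lookup (lookup rules s) a) (lookup labels)
    rules-lookup (λ s → sym (lookup∘tabulate res s)) public

  module Untabulate = Twins N′ δ res (λ s a → sym (rules-lookup s a)) (λ s → lookup∘tabulate res s)

  tabulated-steps : ∀ {D x t c} → Steps N′ D (initial N′ x) t c →
    Steps N D (initial N x) t (Untabulate.twin c)
  tabulated-steps {D} {x} {t} {c} ss =
    subst (λ c₀ → Steps N D c₀ t (Untabulate.twin c)) (Untabulate.twin-initial x) (Untabulate.twin-steps ss)

-- The state `start` in `Fin Q` rules out `Q = 0`, so the shift in the number of states loses no
-- machine.
codeOf : (N : NOTM) → ∃ λ code → decode code ≡ Tabulate.N′ N
codeOf N@(record { Q = suc q ; Γ = Γ ; start = start ; qQ = qQ ; qY = qY ; qN = qN }) =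
  ((q , Γ) , (start , qQ , qY , qN) , Tabulate.rules N , Tabulate.labels N) , refl

TimeBound : NOTM → ℕ → ℕ → Set
TimeBound N c k = ∀ D x t c' → Steps N D (initial N x) t c' → t ≤ c * length x ^ k + c

Reduces : NOTM → Lang → Lang → Set
Reduces N A B = Overproductive N B × Underproductive N B × Decides N B A

Clocked-countable : Countable (Code × ℕ × ℕ)
Clocked-countable = Code-countable ×-countable (ℕ-countable ×-countable ℕ-countable)

decodeClocked : Code × ℕ × ℕ → NOTM × ℕ × ℕ
decodeClocked (code , c , k) = decode code , c , k

abstract
  clocked : ℕ → NOTM × ℕ × ℕ
  clocked n = decodeClocked (enum Clocked-countable n)

  -- Up to pointwise equality of the transition function, every machine with every clock is listed.
  ≤U⇒listed : ∀ {X Y} → X ≤U Y → ∃ λ e → let (N , c , k) = clocked e in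
    TimeBound N c k × RobustlyUnderproductive N × Reduces N X Y
  ≤U⇒listed {X} {Y} (record { machine = N ; poly = c , k , bound } , under , over , _ , decides) =
    e , subst Good (sym clocked-e) (bound′ , under′ , over′ , under′ Y , decides′)
    where
    open Tabulate N
    open Equivalence
    Good : NOTM × ℕ × ℕ → Set
    Good (N , c , k) = TimeBound N c k × RobustlyUnderproductive N × Reduces N X Y
    e : ℕ
    e = index Clocked-countable (proj₁ (codeOf N) , c , k)
    clocked-e : clocked e ≡ (N′ , c , k)
    clocked-e = trans (cong (λ (code , c , k) → decode code , c , k)
      (enum-index Clocked-countable (proj₁ (codeOf N) , c , k))) (cong (_, (c , k)) (proj₂ (codeOf N)))
    bound′ : TimeBound N′ c k
    bound′ D x t c' ss = bound D x t _ (tabulated-steps ss)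
    under′ : RobustlyUnderproductive N′
    under′ D x (a , r) = under D x (Untabulate.twin-produces a , Untabulate.twin-produces r)
    over′ : Overproductive N′ Y
    over′ x h = over x λ o → mk⇔ (λ p → to (h o) (twin-produces p))
      (λ eq → Untabulate.twin-produces (from (h o) eq))
    decides′ : Decides N′ Y X
    decides′ x = mk⇔ (λ eq → twin-produces (to (decides x) eq))
      (λ p → from (decides x) (Untabulate.twin-produces p))

-- Collisions and oracles with prescribed labels

_≟ˢ_ : (x y : Str) → Dec (x ≡ y)
_≟ˢ_ = ≡-dec Bool._≟_

open import Data.List.Membership.DecPropositional _≟ˢ_ using (_∈?_)

marks : ℕ → ℕ → Str
marks i j = replicate i true ++ replicate j false

-- An oracle D is read, at every m, as a map f from strings of length m + 1 to strings of
-- length m: bit i of f x is D (1^i 0^(m-i) x).  The remaining string 1^m x holds a label of x.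
record Collision (D : Lang) (m : ℕ) : Set where
  field
    left right   : Str
    length-left  : length left ≡ suc m
    length-right : length right ≡ suc m
    distinct     : left ≢ right
    agree        : ∀ i j → i + suc j ≡ m → D (marks i (suc j) ++ left) ≡ D (marks i (suc j) ++ right)

  label : Bool
  label = D (marks m 0 ++ left)

open Collision public using (label)

module Bits = Inverse 2↔Bool

to-injective : ∀ {a b} → Bits.to a ≡ Bits.to b → a ≡ b
to-injective {a} {b} eq =
  trans (sym (Bits.strictlyInverseʳ a)) (trans (cong Bits.from eq) (Bits.strictlyInverseʳ b))

from-injective : ∀ {a b} → Bits.from a ≡ Bits.from b → a ≡ b
from-injective {a} {b} eq =
  trans (sym (Bits.strictlyInverseˡ a)) (trans (cong Bits.to eq) (Bits.strictlyInverseˡ b))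

string : ∀ n → Fin (2 ^ n) → Str
string zero    _ = []
string (suc n) i = Bits.to (proj₁ (remQuot (2 ^ n) i)) ∷ string n (proj₂ (remQuot {2} (2 ^ n) i))

length-string : ∀ n i → length (string n i) ≡ n
length-string zero    i = refl
length-string (suc n) i = cong suc (length-string n _)

string-injective : ∀ n {i j} → string n i ≡ string n j → i ≡ j
string-injective zero {zero} {zero} eq = refl
string-injective (suc n) {i} {j} eq with ∷-injective eq
... | eq₁ , eq₂ = begin
  i ≡⟨ combine-remQuot {2} (2 ^ n) i ⟨
  combine (proj₁ (remQuot {2} (2 ^ n) i)) (proj₂ (remQuot {2} (2 ^ n) i))
    ≡⟨ cong₂ combine (to-injective eq₁) (string-injective n eq₂) ⟩
  combine (proj₁ (remQuot {2} (2 ^ n) j)) (proj₂ (remQuot {2} (2 ^ n) j))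
    ≡⟨ combine-remQuot {2} (2 ^ n) j ⟩
  j ∎
  where open ≡-Reasoning

module _ (D : Lang) (m : ℕ) where

  -- For `i : Fin m` the number `m ∸ toℕ i` of zeros is positive, so the label string 1^m x is never
  -- read here.
  value : Str → Fin m → Fin 2
  value x i = Bits.from (D (marks (toℕ i) (m ∸ toℕ i) ++ x))

  value-agree : ∀ {x y} → funToFin (value x) ≡ funToFin (value y) →
    ∀ i j → i + suc j ≡ m → D (marks i (suc j) ++ x) ≡ D (marks i (suc j) ++ y)
  value-agree {x} {y} eq i j i+j≡m = subst Agree (toℕ-fromℕ< i<m)
    (subst (λ k → D (marks (toℕ t) k ++ x) ≡ D (marks (toℕ t) k ++ y)) rem agree-t)
    where
    i<m : i < m
    i<m = subst (suc i ≤_) (trans (sym (+-suc i j)) i+j≡m) (m≤m+n (suc i) j)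
    t : Fin m
    t = fromℕ< i<m
    Agree : ℕ → Set
    Agree i = D (marks i (suc j) ++ x) ≡ D (marks i (suc j) ++ y)
    rem : m ∸ toℕ t ≡ suc j
    rem = trans (cong₂ _∸_ (sym i+j≡m) (toℕ-fromℕ< i<m)) (m+n∸m≡n i (suc j))
    agree-t : D (marks (toℕ t) (m ∸ toℕ t) ++ x) ≡ D (marks (toℕ t) (m ∸ toℕ t) ++ y)
    agree-t = from-injective (begin
      value x t                       ≡⟨ finToFun-funToFin (value x) t ⟨
      finToFun (funToFin (value x)) t ≡⟨ cong (λ k → finToFun k t) eq ⟩
      finToFun (funToFin (value y)) t ≡⟨ finToFun-funToFin (value y) t ⟩
      value y t                       ∎)
      where open ≡-Reasoning

  abstract
    -- Pigeonhole: there are `2 ^ suc m` strings but only `2 ^ m` values `funToFin (value x)`.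
    collision : Collision D m
    collision with pigeonhole (^-monoʳ-< 2 (s≤s (s≤s z≤n)) (n<1+n m))
      (λ i → funToFin (value (string (suc m) i)))
    ... | i , j , i<j , eq = record
      { left = string (suc m) i ; right = string (suc m) j
      ; length-left = length-string (suc m) i ; length-right = length-string (suc m) j
      ; distinct = λ same → Fin.<⇒≢ i<j (string-injective (suc m) same)
      ; agree = value-agree eq }

-- Completions of partial injections

odd : ℕ → Bool
odd zero    = false
odd (suc n) = not (odd n)

digit : ℕ → ℕ → Bool
digit zero    a = odd a
digit (suc i) a = digit i ⌊ a /2⌋

digit-zero : ∀ i → digit i 0 ≡ false
digit-zero zero    = refl
digit-zero (suc i) = digit-zero i

odd-half-injective : ∀ a b → odd a ≡ odd b → ⌊ a /2⌋ ≡ ⌊ b /2⌋ → a ≡ b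
odd-half-injective 0 0 _ _ = refl
odd-half-injective 1 1 _ _ = refl
odd-half-injective 0 1 () _
odd-half-injective 0 (suc (suc b)) _ ()
odd-half-injective 1 (suc (suc b)) _ ()
odd-half-injective (suc (suc a)) (suc (suc b)) p q =
  cong (λ n → suc (suc n)) (odd-half-injective a b (Bool.not-injective (Bool.not-injective p)) (suc-injective q))

half-< : ∀ a k → a < k + k → ⌊ a /2⌋ < k
half-< 0 (suc k) _ = s≤s z≤n
half-< 1 (suc k) _ = s≤s z≤n
half-< (suc (suc a)) (suc k) (s≤s p) rewrite +-suc k k = s≤s (half-< a k (≤-pred p))

-- Halving reduces `m` by one. The index condition `i + suc j ≡ m` is that of `Collision.agree`.
bits-injective : ∀ m {a b} → a < 2 ^ m → b < 2 ^ m →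
  (∀ i j → i + suc j ≡ m → digit i a ≡ digit i b) → a ≡ b
bits-injective zero (s≤s z≤n) (s≤s z≤n) _ = refl
bits-injective (suc m) {a} {b} a< b< same = odd-half-injective a b (same 0 m refl)
  (bits-injective m (half-< a (2 ^ m) (subst (a <_) double a<)) (half-< b (2 ^ m) (subst (b <_) double b<))
    λ i j eq → same (suc i) j (cong suc eq))
  where
  double : 2 ^ suc m ≡ 2 ^ m + 2 ^ m
  double = cong (2 ^ m +_) (+-identityʳ (2 ^ m))

-- Position of a string in a list, counted from the end so that it survives extensions of the
-- list; 0 when absent.
position : List Str → Str → ℕ
position []      x = 0
position (z ∷ ρ) x with position ρ x
... | suc k = suc k
... | zero  with z ≟ˢ x
...   | yes _ = suc (length ρ)
...   | no _  = 0

position-≤ : ∀ ρ x → position ρ x ≤ length ρ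
position-≤ [] x = z≤n
position-≤ (z ∷ ρ) x with position ρ x | position-≤ ρ x
... | suc k | le = m≤n⇒m≤1+n le
... | zero  | _ with z ≟ˢ x
...   | yes _ = ≤-refl
...   | no _  = z≤n

position-injective : ∀ ρ {x y} → position ρ x ≡ position ρ y → position ρ x ≢ 0 → x ≡ y
position-injective [] _ ≢0 = contradiction refl ≢0
position-injective (z ∷ ρ) {x} {y} eq ≢0
  with position ρ x in px | position ρ y in py | position-≤ ρ x | position-≤ ρ y
... | suc k | suc l | _ | _ =
  position-injective ρ (trans px (trans eq (sym py))) λ p → contradiction (trans (sym px) p) λ ()
position-injective (z ∷ ρ) {x} {y} eq ≢0 | zero | zero | _ | _ with z ≟ˢ x | z ≟ˢ y
... | yes refl | yes refl = refl
... | yes _    | no _     = contradiction eq λ ()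
... | no _     | _        = contradiction refl ≢0
position-injective (z ∷ ρ) {x} {y} eq ≢0 | suc k | zero | le | _ with z ≟ˢ y
... | yes _ = contradiction (subst (_≤ length ρ) eq le) (1+n≰n)
... | no _  = contradiction eq λ ()
position-injective (z ∷ ρ) {x} {y} eq ≢0 | zero | suc l | _ | le with z ≟ˢ x
... | yes _ = contradiction (subst (_≤ length ρ) (sym eq) le) (1+n≰n)
... | no _  = contradiction refl ≢0

position-extend : ∀ zs {ρ x} → position ρ x ≢ 0 → position (zs ++ ρ) x ≡ position ρ x
position-extend []       _ = refl
position-extend (z ∷ zs) {ρ} {x} ≢0 with position (zs ++ ρ) x | position-extend zs {ρ} {x} ≢0
... | suc k | eq = eq
... | zero  | eq = contradiction (sym eq) ≢0

position-∈ : ∀ {zs} ρ {x} → x ∈ zs → position (zs ++ ρ) x ≢ 0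
position-∈ {z ∷ zs} ρ {x} i with position (zs ++ ρ) x in eq
... | suc k = λ ()
position-∈ {z ∷ zs} ρ {x} (there i) | zero = contradiction eq (position-∈ ρ i)
position-∈ {z ∷ zs} ρ {x} (here refl) | zero with x ≟ˢ x
... | yes _ = λ ()
... | no ¬p = contradiction refl ¬p

-- Recovers `i` from `marks i j`; this is how `complete` reads off which bit a query asks for.
trues : Str → ℕ
trues []          = 0
trues (true ∷ w)  = suc (trues w)
trues (false ∷ w) = trues w

trues-marks : ∀ i j → trues (marks i j) ≡ i
trues-marks zero    zero    = refl
trues-marks zero    (suc j) = trues-marks zero j
trues-marks (suc i) j       = cong suc (trues-marks i j)

length-marks : ∀ i j → length (marks i j) ≡ i + j
length-marks i j = trans (length-++ (replicate i true)) (cong₂ _+_ (length-replicate i) (length-replicate j))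

take-++-length : ∀ {A : Set} (xs ys : List A) → take (length xs) (xs ++ ys) ≡ xs
take-++-length []       ys = refl
take-++-length (x ∷ xs) ys = cong (x ∷_) (take-++-length xs ys)

drop-++-length : ∀ {A : Set} (xs ys : List A) → drop (length xs) (xs ++ ys) ≡ ys
drop-++-length []       ys = refl
drop-++-length (x ∷ xs) ys = drop-++-length xs ys

-- The string at position k of ρ is mapped to the binary digits of k, all others to 0^m with
-- label b: hence all collisions have label b.
entry : ℕ → ℕ → ℕ → Bool → Bool
entry m i zero    b = if i ≡ᵇ m then b else false
entry m i (suc k) b = digit i (suc k)

-- Marks of length `m` followed by a string of length `m + 1` make up length `m + suc m`. Different
-- `m` occupy different lengths, so their completions do not interfere.
complete : Lang → ℕ → List Str → Bool → Lang
complete O m ρ b q with length q ≟ m + suc m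
... | yes _ = entry m (trues (take m q)) (position ρ (drop m q)) b
... | no _  = O q

complete-inside : ∀ O m ρ b i j {x} → i + j ≡ m → length x ≡ suc m →
  complete O m ρ b (marks i j ++ x) ≡ entry m i (position ρ x) b
complete-inside O .(i + j) ρ b i j {x} refl lx with length (marks i j ++ x) ≟ i + j + suc (i + j)
... | no ¬p = contradiction (trans (length-++ (marks i j)) (cong₂ _+_ (length-marks i j) lx)) ¬p
... | yes _ rewrite sym (length-marks i j) | take-++-length (marks i j) x
                  | drop-++-length (marks i j) x | trues-marks i j = refl

complete-outside : ∀ O m ρ b {q} → length q ≢ m + suc m → complete O m ρ b q ≡ O q
complete-outside O m ρ b {q} ≢ with length q ≟ m + suc m
... | yes p = contradiction p ≢
... | no _  = refl

-- The strings whose answer is not yet settled by `ρ`: by `complete-agree`, all others keep their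
-- answer when `ρ` is extended or the label is changed.
Free : ℕ → List Str → Str → Set
Free m ρ q = length q ≡ m + suc m × position ρ (drop m q) ≡ 0

complete-agree : ∀ O m ρ zs b b' q → ¬ Free m ρ q → complete O m ρ b q ≡ complete O m (zs ++ ρ) b' q
complete-agree O m ρ zs b b' q bound with length q ≟ m + suc m
... | no _  = refl
... | yes p with position ρ (drop m q) | position-extend zs {ρ} {drop m q}
...   | zero  | _ = contradiction (p , refl) bound
...   | suc k | extend rewrite extend (λ ()) = refl

Promise : Lang → ℕ → Bool → Set
Promise D m b = ∀ (κ : Collision D m) → label κ ≡ b

≢⇒≡ᵇ : ∀ {i m} → i < m → (i ≡ᵇ m) ≡ false
≢⇒≡ᵇ {zero}  {suc m} _       = refl
≢⇒≡ᵇ {suc i} {suc m} (s≤s p) = ≢⇒≡ᵇ p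

-- An absent string has position 0, and all binary digits of 0 are `false`; so below the label bit
-- one formula covers placed and absent strings.
entry-digit : ∀ {m i} k b → i < m → entry m i k b ≡ digit i k
entry-digit {m} {i} zero b i<m rewrite ≢⇒≡ᵇ i<m = sym (digit-zero i)
entry-digit (suc k) b i<m = refl

entry-label : ∀ m b → entry m m 0 b ≡ b
entry-label zero    b = refl
entry-label (suc m) b = entry-label m b

-- The value of a string is its position, which is below `2 ^ m` and hence determined by its digits.
-- Placed strings have distinct nonzero positions, so two different strings collide only at position
-- 0, where the label is `b`.
complete-promise : ∀ O m ρ b → length ρ < 2 ^ m → Promise (complete O m ρ b) m b
complete-promise O m ρ b small κ
  with position ρ (Collision.left κ) in px
... | suc k = contradiction
      (position-injective ρ same λ p → contradiction (trans (sym px) p) λ ()) (Collision.distinct κ)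
  where
  evaluate : ∀ i j {x} → i + suc j ≡ m → length x ≡ suc m →
    complete O m ρ b (marks i (suc j) ++ x) ≡ digit i (position ρ x)
  evaluate i j eq lx = trans (complete-inside O m ρ b i (suc j) eq lx)
    (entry-digit _ b (subst (suc i ≤_) (trans (sym (+-suc i j)) eq) (m≤m+n (suc i) j)))
  same : position ρ (Collision.left κ) ≡ position ρ (Collision.right κ)
  same = bits-injective m (≤-<-trans (position-≤ ρ _) small) (≤-<-trans (position-≤ ρ _) small)
    λ i j eq → trans (sym (evaluate i j eq (Collision.length-left κ)))
      (trans (Collision.agree κ i j eq) (evaluate i j eq (Collision.length-right κ)))
... | zero = trans (complete-inside O m ρ b m 0 (+-identityʳ m) (Collision.length-left κ))
      (trans (cong (λ k → entry m m k b) px) (entry-label m b))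

-- A collision at `m` speaks only of strings of length `m + suc m`, so a collision of `D'` is also
-- one of `D`, with the same label.
promise-local : ∀ {D D' m b} → (∀ {q} → length q ≡ m + suc m → D q ≡ D' q) →
  Promise D m b → Promise D' m b
promise-local {D} {D'} {m} same p κ = trans
  (sym (same (trans (length-++ (marks m 0)) (cong₂ _+_ (trans (length-marks m 0) (+-identityʳ m)) (Collision.length-left κ)))))
  (p (record
    { left = Collision.left κ ; right = Collision.right κ
    ; length-left = Collision.length-left κ ; length-right = Collision.length-right κ ; distinct = Collision.distinct κ
    ; agree = λ i j eq → trans (same (size i j eq (Collision.length-left κ)))
        (trans (Collision.agree κ i j eq) (sym (same (size i j eq (Collision.length-right κ))))) }))
  where
  size : ∀ i j {x} → i + suc j ≡ m → length x ≡ suc m → length (marks i (suc j) ++ x) ≡ m + suc m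
  size i j eq lx = trans (length-++ (marks i (suc j))) (cong₂ _+_ (trans (length-marks i (suc j)) eq) lx)

-- The adversary

length-filter-< : ∀ {A : Set} {P Z : A → Set} (P? : Decidable P) (Z? : Decidable Z) →
  (∀ {x} → P x → Z x) → ∀ {y xs} → y ∈ xs → Z y → ¬ P y →
  length (filter P? xs) < length (filter Z? xs)
length-filter-< {P = P} {Z} P? Z? P⊆Z = strict
  where
  weak : ∀ xs → length (filter P? xs) ≤ length (filter Z? xs)
  weak [] = z≤n
  weak (x ∷ xs) with P? x | Z? x
  ... | yes p | yes r = s≤s (weak xs)
  ... | yes p | no ¬r = contradiction (P⊆Z p) ¬r
  ... | no _  | yes r = m≤n⇒m≤1+n (weak xs)
  ... | no _  | no _  = weak xs
  strict : ∀ {y xs} → y ∈ xs → Z y → ¬ P y → length (filter P? xs) < length (filter Z? xs)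
  strict {xs = x ∷ xs} (here refl) Zy ¬Py with P? x | Z? x
  ... | yes p | _     = contradiction p ¬Py
  ... | no _  | yes _ = s≤s (weak xs)
  ... | no _  | no ¬r = contradiction Zy ¬r
  strict {xs = x ∷ xs} (there i) Zy ¬Py with P? x | Z? x
  ... | yes p | yes r = s≤s (strict i Zy ¬Py)
  ... | yes p | no ¬r = contradiction (P⊆Z p) ¬r
  ... | no _  | yes r = m≤n⇒m≤1+n (strict i Zy ¬Py)
  ... | no _  | no _  = strict i Zy ¬Py

free? : ∀ m ρ → Decidable (Free m ρ)
free? m ρ q = (length q ≟ m + suc m) ×-dec (position ρ (drop m q) ≟ 0)

free-shrink : ∀ {m} zs {ρ q} → Free m (zs ++ ρ) q → Free m ρ q
free-shrink {m} zs {ρ} {q} (l , p) with position ρ (drop m q) | position-extend zs {ρ} {drop m q}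
... | zero  | _ = l , refl
... | suc k | extend = contradiction (trans (sym (extend λ ())) p) λ ()

-- The length is `m + 1` because `X` and the searching machine take `pred (length x)` as their
-- parameter.
tally : ℕ → Str
tally m = replicate (suc m) false

module Adversary (N : NOTM) (m T : ℕ) where
  open Runs N

  begin : Conf
  begin = initial N (tally m)

  adversary : Lang → ℕ → List Str → List Str × Bool
  adversary O zero    ρ = ρ , false
  adversary O (suc k) ρ with search (complete O m ρ true) T begin acc
  -- Dropping the `m` marks leaves the string asked about. Placing it may change the answer once,
  -- but the answer is the same in all later rounds.
  ... | yes p = adversary O k (map (drop m) (queries p) ++ ρ)
  ... | no  _ = ρ , true

  played : Lang → ℕ → List Str → Lang
  played O k ρ = let (ρ′ , b) = adversary O k ρ in complete O m ρ′ b

  adversary-length : ∀ O k ρ → length (proj₁ (adversary O k ρ)) ≤ k * T + length ρ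
  adversary-length O zero    ρ = ≤-refl
  adversary-length O (suc k) ρ with search (complete O m ρ true) T begin acc
  ... | no _  = m≤n+m _ _
  ... | yes p = ≤-trans (adversary-length O k _) (≤-trans
      (+-monoʳ-≤ (k * T) (≤-trans (≤-reflexive (trans (length-++ (map (drop m) (queries p)))
          (cong (_+ length ρ) (length-map (drop m) (queries p)))))
        (+-monoˡ-≤ (length ρ) (≤-trans (length-asked (steps p)) (within p)))))
      (≤-reflexive (rearrange (k * T) T (length ρ))))
    where
    rearrange : ∀ a b c → a + (b + c) ≡ b + a + c
    rearrange = solve-∀

  adversary-extends : ∀ O k ρ → ∃ λ zs → proj₁ (adversary O k ρ) ≡ zs ++ ρ
  adversary-extends O zero    ρ = [] , refl
  adversary-extends O (suc k) ρ with search (complete O m ρ true) T begin acc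
  ... | no _  = [] , refl
  ... | yes p with adversary-extends O k (map (drop m) (queries p) ++ ρ)
  ...   | zs , eq = zs ++ map (drop m) (queries p) ,
    trans eq (sym (++-assoc zs (map (drop m) (queries p)) ρ))

  module _ (robust : RobustlyUnderproductive N) where

    -- Otherwise both paths survive under an oracle that follows D₁ on the queries of the
    -- first path and D₀ elsewhere.
    conflict : ∀ {D₁ D₀ b c o} (p₁ : Path D₁ begin b acc) (p₀ : Path D₀ begin c o) → o ≡ rej →
      ∃ λ q → q ∈ queries p₁ × q ∈ queries p₀ × D₁ q ≢ D₀ q
    conflict {D₁} {D₀} p₁ p₀ refl
      with any? (λ q → (q ∈? queries p₀) ×-dec ¬? (D₁ q Bool.≟ D₀ q)) (queries p₁)
    ... | yes a = let (q , i , j , d) = find a in q , i , j , d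
    ... | no none = ⊥-elim (robust D (tally m)
        ( (time p₁ , final p₁ , reroute (steps p₁) first , halted-any (halts p₁) , outcome p₁)
        , (time p₀ , final p₀ , reroute (steps p₀) second , halted-any (halts p₀) , outcome p₀)))
      where
      D : Lang
      D q with q ∈? queries p₁
      ... | yes _ = D₁ q
      ... | no  _ = D₀ q
      first : ∀ {q} → q ∈ queries p₁ → D₁ q ≡ D q
      first {q} i with q ∈? queries p₁
      ... | yes _ = refl
      ... | no ¬i = contradiction i ¬i
      second : ∀ {q} → q ∈ queries p₀ → D₀ q ≡ D q
      second {q} j with q ∈? queries p₁
      ... | no _  = refl
      ... | yes i = decidable-stable (D₀ q Bool.≟ D₁ q) λ d → none (lose i (j , λ e → d (sym e)))

    -- The accepting path of a round contributes a query of the final rejecting path that is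
    -- free before the round but not after it.
    adversary-round : ∀ O k ρ (p₁ : Path (complete O m ρ true) begin T acc) →
      let ρ₁ = map (drop m) (queries p₁) ++ ρ ; b = proj₂ (adversary O k ρ₁) in
      (p : Path (played O k ρ₁) begin T (verdict b)) → b ≡ false →
      length (filter (free? m ρ₁) (queries p)) < length (filter (free? m ρ) (queries p))
    adversary-round O k ρ p₁ p b≡false
      with conflict p₁ p (cong verdict b≡false)
         | adversary-extends O k (map (drop m) (queries p₁) ++ ρ)
    ... | q , i , j , differ | zs , ext =
      length-filter-< (free? m (xs ++ ρ)) (free? m ρ) (free-shrink xs) j
        (decidable-stable (free? m ρ q) λ bound → differ
          (trans (complete-agree O m ρ (zs ++ xs) true b q bound)
            (cong (λ ρ′ → complete O m ρ′ b q) (trans (++-assoc zs xs ρ) (sym ext)))))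
        (λ (_ , unplaced) → position-∈ ρ (∈-map⁺ (drop m) i) unplaced)
      where
      xs : List Str
      xs = map (drop m) (queries p₁)
      b : Bool
      b = proj₂ (adversary O k (xs ++ ρ))

    -- If a search failed, the label would be `true` and `p` an accepting path under the very oracle
    -- that was searched. So all `k` searches succeed, and each round adds a query of `p` to the
    -- count by `adversary-round`.
    adversary-wins : ∀ O k ρ → let b = proj₂ (adversary O k ρ) in
      (p : Path (played O k ρ) begin T (verdict b)) →
      b ≡ false × k ≤ length (filter (free? m ρ) (queries p))
    adversary-wins O zero    ρ p = refl , z≤n
    adversary-wins O (suc k) ρ p with search (complete O m ρ true) T begin acc
    ... | no none = contradiction p none
    ... | yes p₁ with adversary-wins O k (map (drop m) (queries p₁) ++ ρ) p
    ...   | b≡false , more = b≡false , ≤-<-trans more (adversary-round O k ρ p₁ p b≡false)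

-- Exponential room beyond polynomial clocks

n<2^n : ∀ n → n < 2 ^ n
n<2^n zero    = s≤s z≤n
n<2^n (suc n) = ≤-trans (s≤s (n<2^n n)) (≤-trans (+-monoˡ-≤ (2 ^ n) (m^n>0 2 n))
  (≤-reflexive (cong (2 ^ n +_) (sym (+-identityʳ (2 ^ n))))))

time-bound : ℕ → ℕ → ℕ → ℕ
time-bound c k m = c * suc m ^ k + c

-- One round more than the running time, with as many queries in each round, still leaves strings
-- of length m unused.
abstract
  ample : ∀ c k l → ∃ λ m → l ≤ m × (let T = time-bound c k m in suc T * T < 2 ^ m)
  ample c k l = m , ≤-trans l≤i i≤m , room
    where
    -- With `suc m` a power of 2, the running time is below `2 ^ a` for an `a` linear in `i`, while
    -- `suc m` is at least the square of `suc i`. The summands `3 + 2 * c` and `4 * k` are what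
    -- `a + a ≤ m` requires, and `l` gives `l ≤ i`.
    i : ℕ
    i = l + (3 + 2 * c + 4 * k)
    m : ℕ
    m = pred (2 ^ (2 * i))
    suc-m : suc m ≡ 2 ^ (2 * i)
    suc-m = suc-pred (2 ^ (2 * i)) {{m^n≢0 2 (2 * i)}}
    T : ℕ
    T = time-bound c k m
    l≤i : l ≤ i
    l≤i = m≤m+n l _
    square : suc i * suc i ≤ suc m
    square = begin
      suc i * suc i   ≤⟨ *-mono-≤ (n<2^n i) (n<2^n i) ⟩
      2 ^ i * 2 ^ i   ≡⟨ ^-distribˡ-+-* 2 i i ⟨
      2 ^ (i + i)     ≡⟨ cong (2 ^_) (cong (i +_) (sym (+-identityʳ i))) ⟩
      2 ^ (2 * i)     ≡⟨ suc-m ⟨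
      suc m           ∎
      where open ≤-Reasoning
    i≤m : i ≤ m
    i≤m = ≤-pred (≤-trans (m≤m*n (suc i) (suc i)) square)
    a : ℕ
    a = suc (c + 2 * i * k)
    P : ℕ
    P = suc m ^ k
    P≡ : P ≡ 2 ^ (2 * i * k)
    P≡ = trans (cong (_^ k) suc-m) (^-*-assoc 2 (2 * i) k)
    time≤ : suc T ≤ 2 ^ a
    time≤ = begin
      suc (c * P + c)                ≡⟨ +-suc (c * P) c ⟨
      c * P + suc c                  ≤⟨ +-mono-≤ (*-monoˡ-≤ P (n≤1+n c)) (m≤m*n (suc c) P {{m^n≢0 (suc m) k}}) ⟩
      suc c * P + suc c * P          ≡⟨ cong (suc c * P +_) (+-identityʳ (suc c * P)) ⟨
      2 * (suc c * P)                ≤⟨ *-monoʳ-≤ 2 (*-mono-≤ (n<2^n c) (≤-reflexive P≡)) ⟩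
      2 * (2 ^ c * 2 ^ (2 * i * k))  ≡⟨ cong (2 *_) (^-distribˡ-+-* 2 c (2 * i * k)) ⟨
      2 ^ a                          ∎
      where open ≤-Reasoning
    a+a≤m : a + a ≤ m
    a+a≤m = ≤-pred (begin
      suc (a + a)                     ≡⟨ regroup c i k ⟩
      (3 + 2 * c) + 4 * k * i         ≤⟨ +-mono-≤ (≤-trans (m≤m+n (3 + 2 * c) (4 * k)) (m≤n+m _ l))
                                         (*-monoˡ-≤ i (≤-trans (m≤n+m (4 * k) (3 + 2 * c)) (m≤n+m _ l))) ⟩
      i + i * i                       ≤⟨ *-monoʳ-≤ (suc i) (n≤1+n i) ⟩
      suc i * suc i                   ≤⟨ square ⟩
      suc m                           ∎)
      where
      open ≤-Reasoning
      regroup : ∀ c i k → suc (suc (c + 2 * i * k) + suc (c + 2 * i * k)) ≡ (3 + 2 * c) + 4 * k * i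
      regroup = solve-∀
    room : suc T * T < 2 ^ m
    room = begin-strict
      suc T * T      <⟨ *-monoʳ-< (suc T) (n<1+n T) ⟩
      suc T * suc T  ≤⟨ *-mono-≤ time≤ time≤ ⟩
      2 ^ a * 2 ^ a  ≡⟨ ^-distribˡ-+-* 2 a a ⟨
      2 ^ (a + a)    ≤⟨ ^-monoʳ-≤ 2 a+a≤m ⟩
      2 ^ m          ∎
      where open ≤-Reasoning

-- The stages of the construction

machineAt : ℕ → NOTM
machineAt e = proj₁ (clocked e)

clockAt : ℕ → ℕ → ℕ
clockAt e m = let (_ , c , k) = clocked e in time-bound c k m

-- ν e is the tally length spoiled at stage e.
abstract
  mutual
    ν : ℕ → ℕ
    ν e = let (_ , c , k) = clocked e in proj₁ (ample c k (threshold e))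

    -- The next length exceeds `ν e` as well as the running time at stage `e`: later stages then
    -- change only strings too long to be asked in that time.
    threshold : ℕ → ℕ
    threshold zero    = 0
    threshold (suc e) = suc (ν e + clockAt e (ν e))

  ν-suc : ∀ e → suc (ν e + clockAt e (ν e)) ≤ ν (suc e)
  ν-suc e = let (_ , c , k) = clocked (suc e) in proj₁ (proj₂ (ample c k (threshold (suc e))))

  ν-room : ∀ e → suc (clockAt e (ν e)) * clockAt e (ν e) < 2 ^ ν e
  ν-room e = let (_ , c , k) = clocked e in proj₂ (proj₂ (ample c k (threshold e)))

stageTime : ℕ → ℕ
stageTime e = clockAt e (ν e)

ν-step : ∀ e → ν e < ν (suc e)
ν-step e = ≤-trans (s≤s (m≤m+n (ν e) (stageTime e))) (ν-suc e)

ν-mono : ∀ d e → ν e ≤ ν (d + e)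
ν-mono zero    e = ≤-refl
ν-mono (suc d) e = ≤-trans (ν-mono d e) (<⇒≤ (ν-step (d + e)))

ν-≥ : ∀ e → e ≤ ν e
ν-≥ zero    = z≤n
ν-≥ (suc e) = ≤-<-trans (ν-≥ e) (ν-step e)

abstract
  stage : ℕ → Lang
  stage zero    _ = false
  stage (suc e)   = Adversary.played (machineAt e) (ν e) (stageTime e) (stage e) (suc (stageTime e)) []

  stage-zero : ∀ q → stage 0 q ≡ false
  stage-zero q = refl

  stage-suc : ∀ e →
    stage (suc e) ≡ Adversary.played (machineAt e) (ν e) (stageTime e) (stage e) (suc (stageTime e)) []
  stage-suc e = refl

play : ℕ → List Str × Bool
play e = Adversary.adversary (machineAt e) (ν e) (stageTime e) (stage e) (suc (stageTime e)) []

stage-inside : ∀ e {b} → Promise (complete (stage e) (ν e) (proj₁ (play e)) (proj₂ (play e))) (ν e) b →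
  Promise (stage (suc e)) (ν e) b
stage-inside e {b} = subst (λ D → Promise D (ν e) b) (sym (stage-suc e))

stage-outside : ∀ e {q} → length q ≢ ν e + suc (ν e) → stage (suc e) q ≡ stage e q
stage-outside e {q} l = trans (cong (λ D → D q) (stage-suc e))
  (complete-outside (stage e) (ν e) (proj₁ (play e)) (proj₂ (play e)) l)

-- Stage `suc e` differs from stage `e` only at length `ν e + suc (ν e)`, which exceeds `e`. Hence
-- on strings of length n all stages from n + 1 on agree.
Y : Lang
Y q = stage (suc (length q)) q

stage-stable : ∀ d e {q} → length q < ν e + suc (ν e) → stage (d + e) q ≡ stage e q
stage-stable zero    e short = refl
stage-stable (suc d) e short = trans
  (stage-outside (d + e) λ eq →
    <⇒≢ (<-≤-trans short (+-mono-≤ (ν-mono d e) (s≤s (ν-mono d e)))) eq)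
  (stage-stable d e short)

Y-stage : ∀ e {q} → length q < ν e + suc (ν e) → Y q ≡ stage e q
Y-stage e {q} short with ≤-total e (suc (length q))
... | inj₁ e≤ = trans (cong (λ n → stage n q) (sym (m∸n+n≡m e≤))) (stage-stable (suc (length q) ∸ e) e short)
... | inj₂ ≤e = sym (trans (cong (λ n → stage n q) (sym (m∸n+n≡m ≤e)))
  (stage-stable (e ∸ suc (length q)) (suc (length q)) (≤-trans (ν-≥ (suc (length q))) (m≤m+n _ _))))

play-small : ∀ e → length (proj₁ (play e)) < 2 ^ ν e
play-small e = ≤-<-trans (≤-trans
  (Adversary.adversary-length (machineAt e) (ν e) (stageTime e) (stage e) (suc (stageTime e)) [])
  (≤-reflexive (+-identityʳ _))) (ν-room e)

-- Stage 0 is constantly `false`, and each later stage either completes the strings belonging to `m`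
-- or leaves all of them unchanged.
stage-promise : ∀ e m → ∃ (Promise (stage e) m)
stage-promise zero    m = false , λ _ → stage-zero _
stage-promise (suc e) m with m ≟ ν e
... | yes refl = proj₂ (play e) ,
  stage-inside e (complete-promise (stage e) (ν e) (proj₁ (play e)) (proj₂ (play e)) (play-small e))
... | no m≢ with stage-promise e m
...   | b , p = b , promise-local (λ {q} l → sym (stage-outside e
          λ l′ → m≢ (region-injective m (ν e) (trans (sym l) l′)))) p
  where
  region-injective : ∀ a b → a + suc a ≡ b + suc b → a ≡ b
  region-injective a b eq with <-cmp a b
  ... | tri< a<b _ _ = contradiction eq (<⇒≢ (+-mono-<-≤ a<b (s≤s (<⇒≤ a<b))))
  ... | tri≈ _ a≡b _ = a≡b
  ... | tri> _ _ b<a = contradiction (sym eq) (<⇒≢ (+-mono-<-≤ b<a (s≤s (<⇒≤ b<a))))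

Y-promise : ∀ m → ∃ (Promise Y m)
Y-promise m with stage-promise (suc m) m
... | b , p = b , promise-local (λ l → sym (Y-stage (suc m)
  (subst (_< _) (sym l) (+-mono-<-≤ (ν-≥ (suc m)) (≤-trans (ν-≥ (suc m)) (n≤1+n _)))))) p

-- By `Y-promise` every collision of this length carries the same label, so the choice made by
-- `collision` does not affect the value.
X : Lang
X x = label (collision Y (pred (length x)))

-- Diagonalisation against one machine

module Stage (e : ℕ) where
  N : NOTM
  N = machineAt e
  m : ℕ
  m = ν e
  open Runs N
  open Adversary N m (stageTime e)

  region-< : m + suc m < ν (suc e) + suc (ν (suc e))
  region-< = +-mono-< (ν-step e) (s≤s (ν-step e))

  X-tally : X (tally m) ≡ proj₂ (play e)
  X-tally = trans (cong (λ n → label (collision Y n)) (length-replicate m))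
    (promise-local {D = stage (suc e)} (λ {q} l → sym (Y-stage (suc e) (subst (_< _) (sym l) region-<)))
      (stage-inside e (complete-promise (stage e) m (proj₁ (play e)) (proj₂ (play e)) (play-small e))) (collision Y m))

  -- A path with the correct verdict on `tally m` survives when `Y` is replaced by the oracle left
  -- by the adversary. There `adversary-wins` makes it ask more queries than its running time
  -- allows.
  defeated : (let (N , c , k) = clocked e in TimeBound N c k) → RobustlyUnderproductive N → ¬ Reduces N X Y
  defeated bound robust (over , under , decides) = ¬¬answer contradict
    where
    open Equivalence
    b : Bool
    b = proj₂ (play e)
    bounded : Bounded Y begin (stageTime e)
    bounded t c' ss = subst (λ n → let (_ , c , k) = clocked e in t ≤ c * n ^ k + c)
      (length-replicate (suc m)) (bound Y (tally m) t c' ss)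
    oracle : Lang
    oracle = played (stage e) (suc (stageTime e)) []
    local : ∀ {o} → Path Y begin (stageTime e) o → Path oracle begin (stageTime e) o
    local {o} p = subst (λ D → Path D begin (stageTime e) o) (stage-suc e)
      (path (within p)
        -- A query is no longer than the running time, hence shorter than every string changed after
        -- this stage.
        (reroute (steps p) λ i → Y-stage (suc e) (≤-<-trans
          (≤-trans (asked-short (steps p) i) (within p))
          (<-≤-trans (s≤s (m≤n+m (stageTime e) m)) (≤-trans (ν-suc e) (m≤m+n _ _)))))
        (halted-any (halts p)) (outcome p))
    contradict : ¬ Reaches Y begin (verdict b)
    contradict r = 1+n≰n (begin′
      suc (stageTime e)
        ≤⟨ proj₂ (adversary-wins robust (stage e) (suc (stageTime e)) [] p) ⟩
      length (filter (free? m []) (queries p))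
        ≤⟨ length-filter (free? m []) (queries p) ⟩
      length (queries p)
        ≤⟨ length-asked (steps p) ⟩
      time p
        ≤⟨ within p ⟩
      stageTime e ∎)
      where
      open ≤-Reasoning renaming (begin_ to begin′_)
      p : Path oracle begin (stageTime e) (verdict b)
      p = local (reaches-path bounded r)
    -- `Overproductive` is a negation, so for the label `false` a rejecting path is available only
    -- under a double negation; this suffices for refuting.
    ¬¬answer : ¬ ¬ Reaches Y begin (verdict b)
    ¬¬answer with proj₂ (play e) | X-tally
    ... | true  | X≡ = λ no-acc → no-acc (to (decides (tally m)) X≡)
    ... | false | X≡ = λ no-rej → over (tally m) λ
      { acc → mk⇔ (λ r → contradiction (trans (sym X≡) (from (decides (tally m)) r)) λ ()) λ ()
      ; rej → mk⇔ (λ r → contradiction r no-rej) λ ()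
      ; que → mk⇔ (λ _ → refl) λ _ → produces-que no-rej X≡ }
      where
      produces-que : ¬ Reaches Y begin rej → X (tally m) ≡ false → Reaches Y begin que
      produces-que no-rej X≡ with some-outcome (stageTime e) begin bounded
      ... | acc , r = contradiction (trans (sym X≡) (from (decides (tally m)) r)) λ ()
      ... | rej , r = contradiction r no-rej
      ... | que , r = r

X≰Y : ¬ (X ≤U Y)
X≰Y X≤Y with ≤U⇒listed X≤Y
... | e , bound , robust , reduces = Stage.defeated e bound robust reduces

-- A machine searching for collisions

-- A cell carries one bit of each of the two guessed strings.
Pair : Set
Pair = Bool × Bool

-- The strings stand reversed on the tape: the sweep to the left that writes them starts at the
-- `end` cell, which holds their first bits.
data Status : Set where
  fresh  : Status
  seen   : Bool → Status
  passed : Status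
  end    : Status

Cell : Set
Cell = Status × Pair

paint : Status → List Pair → List Cell
paint σ = map (σ ,_)

length-paint : ∀ σ cs ks → length (paint σ cs ʳ++ ks) ≡ length cs + length ks
length-paint σ cs ks = trans (length-ʳ++ (paint σ cs)) (cong (_+ length ks) (length-map (σ ,_) cs))

data Symbol : Set where
  empty : Symbol
  bit   : Bool → Symbol
  edge  : Symbol
  cell  : Cell → Symbol

-- The parameter of left and right selects the string whose query is being written; that of
-- guess tells whether the strings already differ; that of answer and halt is an answer.
data State : Set where
  start  : State
  guess  : Bool → State
  left   : Bool → State
  right  : Bool → State
  query  : State
  answer : Bool → State
  halt   : Bool → State

Action : Set
Action = State × Symbol × Move × Maybe Bool

pick : Bool → Pair → Bool
pick false (x , _) = x
pick true  (_ , y) = y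

pairs : List Pair
pairs = (false , false) ∷ (false , true) ∷ (true , false) ∷ (true , true) ∷ []

differs : Pair → Bool
differs (x , y) = x xor y

-- If the strings agree so far, only unequal bits are offered for the last pair; thus the guessed
-- strings always differ.
ends : Bool → List Pair
ends true  = pairs
ends false = (false , true) ∷ (true , false) ∷ []

-- The sweep that guesses the pairs already writes the marks 0^m of the first query.
guess-cell : Bool → Pair → Action
guess-cell d c = guess (d ∨ differs c) , cell (fresh , c) , R , just false

guess-end : Pair → Action
guess-end c = left false , cell (end , c) , L , just (pick false c)

-- A query 1^i 0^(m-i) x is written by a sweep to the right, emitting one mark per cell, and a
-- sweep to the left, emitting the bits of x.  The unique cell at which the checking stands is
-- the first one which is not passed: it stores the answer for the first string until the second
-- string has been asked for.
actions : State → Symbol → List Action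
actions start          _                   = [ guess false , edge , R , nothing ]
actions (guess d)      (bit _)             = map (guess-cell d) pairs
actions (guess d)      empty               = map guess-end (ends d)
actions (left w)       (cell (s , c))      = [ left w , cell (s , c) , L , just (pick w c) ]
actions (left w)       edge                = [ query , edge , S , nothing ]
actions (right w)      (cell (fresh , c))  = [ right w , cell (fresh , c) , R , just false ]
actions (right w)      (cell (end , c))    = [ left w , cell (end , c) , L , just (pick w c) ]
actions (answer b)     edge                = [ answer b , edge , R , nothing ]
actions (answer b)     (cell (passed , c))   = [ answer b , cell (passed , c) , R , just true ]
actions (answer b)     (cell (fresh , c))  = [ right true , cell (seen b , c) , R , just false ]
actions (answer true)  (cell (seen true , c))   = [ right false , cell (passed , c) , R , just true ]
actions (answer false) (cell (seen false , c))  = [ right false , cell (passed , c) , R , just true ]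
actions (answer b)     (cell (end , c))    = [ halt b , cell (end , c) , S , nothing ]
-- This includes an answer different from the one stored in `seen`: such a path ends here with
-- outcome `que`.
actions _              _                   = []

result : State → Outcome
result (halt b) = verdict b
result _        = que

-- Encoding states and symbols by numbers

encodeStatus : Status → Fin 5
encodeStatus fresh        = # 0
encodeStatus (seen false) = # 1
encodeStatus (seen true)  = # 2
encodeStatus passed       = # 3
encodeStatus end          = # 4

decodeStatus : Fin 5 → Status
decodeStatus = lookup (fresh ∷ seen false ∷ seen true ∷ passed ∷ end ∷ [])

decode-encodeStatus : ∀ s → decodeStatus (encodeStatus s) ≡ s
decode-encodeStatus fresh        = refl
decode-encodeStatus (seen false) = refl
decode-encodeStatus (seen true)  = refl
decode-encodeStatus passed       = refl
decode-encodeStatus end          = refl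

-- The codes 0, 1, 2 are forced by `blank` and `bitSym`; after `edge` there follow 5 * 4 codes for
-- the cells.
encodeSymbol : Symbol → Fin 24
encodeSymbol empty                = # 0
encodeSymbol (bit false)          = # 1
encodeSymbol (bit true)           = # 2
encodeSymbol edge                 = # 3
encodeSymbol (cell (s , x , y))   =
  4 ↑ʳ combine (encodeStatus s) (combine (Bits.from x) (Bits.from y))

decodePair : Fin 2 × Fin 2 → Pair
decodePair (x , y) = Bits.to x , Bits.to y

decodeCell : Fin 5 × Fin 4 → Symbol
decodeCell (s , c) = cell (decodeStatus s , decodePair (remQuot 2 c))

decodeSymbol : Fin 24 → Symbol
decodeSymbol i =
  [ lookup (empty ∷ bit false ∷ bit true ∷ edge ∷ []) , (λ j → decodeCell (remQuot 4 j)) ]′ (splitAt 4 i)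

decode-encodeSymbol : ∀ a → decodeSymbol (encodeSymbol a) ≡ a
decode-encodeSymbol empty              = refl
decode-encodeSymbol (bit false)        = refl
decode-encodeSymbol (bit true)         = refl
decode-encodeSymbol edge               = refl
decode-encodeSymbol (cell (s , x , y)) = trans
  (cong decodeCell (remQuot-combine (encodeStatus s) (combine (Bits.from x) (Bits.from y))))
  (cong₂ (λ t c → cell (t , c)) (decode-encodeStatus s)
    (trans (cong decodePair (remQuot-combine (Bits.from x) (Bits.from y)))
      (cong₂ _,_ (Bits.strictlyInverseˡ x) (Bits.strictlyInverseˡ y))))

encodeState : State → Fin 12
encodeState start          = # 0
encodeState (guess false)  = # 1
encodeState (guess true)   = # 2
encodeState (left false)   = # 3
encodeState (left true)    = # 4
encodeState (right false)  = # 5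
encodeState (right true)   = # 6
encodeState query          = # 7
encodeState (answer false) = # 8
encodeState (answer true)  = # 9
encodeState (halt false)   = # 10
encodeState (halt true)    = # 11

decodeState : Fin 12 → State
decodeState = lookup (start ∷ guess false ∷ guess true ∷ left false ∷ left true ∷ right false ∷
  right true ∷ query ∷ answer false ∷ answer true ∷ halt false ∷ halt true ∷ [])

decode-encodeState : ∀ s → decodeState (encodeState s) ≡ s
decode-encodeState start          = refl
decode-encodeState (guess false)  = refl
decode-encodeState (guess true)   = refl
decode-encodeState (left false)   = refl
decode-encodeState (left true)    = refl
decode-encodeState (right false)  = refl
decode-encodeState (right true)   = refl
decode-encodeState query          = refl
decode-encodeState (answer false) = refl
decode-encodeState (answer true)  = refl
decode-encodeState (halt false)   = refl
decode-encodeState (halt true)    = refl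

encodeAction : Action → Fin 12 × Fin 24 × Move × Maybe Bool
encodeAction (s , a , m , e) = encodeState s , encodeSymbol a , m , e

finder : NOTM
finder = record
  { Q = 12 ; Γ = 21
  ; start = encodeState start ; qQ = encodeState query
  ; qY = encodeState (answer true) ; qN = encodeState (answer false)
  ; δ = λ s a → map encodeAction (actions (decodeState s) (decodeSymbol a))
  ; res = λ s → result (decodeState s) }

module F = Runs finder

-- Runs on decoded configurations

record Situation : Set where
  constructor sit
  field
    state        : State
    before after : List Symbol
    written      : Str

open Situation

code : Situation → Config finder
code (sit s l r q) = cfg (encodeState s) (map encodeSymbol l) (map encodeSymbol r) q

headSymbol : List Symbol → Symbol
headSymbol []      = empty
headSymbol (a ∷ _) = a

tailSymbols : List Symbol → List Symbol
tailSymbols []      = []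
tailSymbols (_ ∷ r) = r

act : List Symbol → List Symbol → Str → Action → Situation
act l       r q (s , a , S , e) = sit s l (a ∷ tailSymbols r) (appendQ finder q e)
act l       r q (s , a , R , e) = sit s (a ∷ l) (tailSymbols r) (appendQ finder q e)
act []      r q (s , a , L , e) = sit s [] (a ∷ tailSymbols r) (appendQ finder q e)
act (z ∷ l) r q (s , a , L , e) = sit s l (z ∷ a ∷ tailSymbols r) (appendQ finder q e)

flag : Bool → List Pair → Bool
flag d []       = d
flag d (c ∷ cs) = flag (d ∨ differs c) cs

∈-pairs : ∀ c → c ∈ pairs
∈-pairs (false , false) = here refl
∈-pairs (false , true)  = there (here refl)
∈-pairs (true , false)  = there (there (here refl))
∈-pairs (true , true)   = there (there (there (here refl)))

∈-ends : ∀ d c → (d ≡ false → differs c ≡ true) → c ∈ ends d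
∈-ends true  c               _ = ∈-pairs c
∈-ends false (false , true)  _ = here refl
∈-ends false (true , false)  _ = there (here refl)
∈-ends false (false , false) h = contradiction (h refl) λ ()
∈-ends false (true , true)   h = contradiction (h refl) λ ()

ends-false : ∀ {c} → c ∈ ends false → pick false c ≢ pick true c
ends-false (here refl) ()
ends-false (there (here refl)) ()

differs-false : ∀ c → differs c ≡ false → pick false c ≡ pick true c
differs-false (false , false) _ = refl
differs-false (true , true)   _ = refl

differs-≢ : ∀ c → pick false c ≢ pick true c → differs c ≡ true
differs-≢ (false , true)  _ = refl
differs-≢ (true , false)  _ = refl
differs-≢ (false , false) h = contradiction refl h
differs-≢ (true , true)   h = contradiction refl h

flag-false : ∀ d cs → flag d cs ≡ false → d ≡ false × map (pick false) cs ≡ map (pick true) cs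
flag-false d [] eq = eq , refl
flag-false d (c ∷ cs) eq with flag-false (d ∨ differs c) cs eq
flag-false false (c ∷ cs) eq | same , tails = refl , cong₂ _∷_ (differs-false c same) tails

flag-equal : ∀ cs → map (pick false) cs ≡ map (pick true) cs → flag false cs ≡ false
flag-equal [] _ = refl
flag-equal ((false , false) ∷ cs) eq = flag-equal cs (proj₂ (∷-injective eq))
flag-equal ((true , true) ∷ cs)   eq = flag-equal cs (proj₂ (∷-injective eq))
flag-equal ((false , true) ∷ cs)  eq = contradiction (proj₁ (∷-injective eq)) λ ()
flag-equal ((true , false) ∷ cs)  eq = contradiction (proj₁ (∷-injective eq)) λ ()

pair-up : ∀ u v → length u ≡ length v → ∃ λ cs → map (pick false) cs ≡ u × map (pick true) cs ≡ v
pair-up []      []      _  = [] , refl , refl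
pair-up (a ∷ u) (b ∷ v) eq with pair-up u v (suc-injective eq)
... | cs , refl , refl = (a , b) ∷ cs , refl , refl

module Finder (D : Lang) where

  follow : Situation → List Situation
  follow (sit query l r q) = [ sit (answer (D q)) l r [] ]
  follow (sit s     l r q) = map (act l r q) (actions s (headSymbol r))

  scanned-code : ∀ r → scanned finder (map encodeSymbol r) ≡ encodeSymbol (headSymbol r)
  scanned-code []      = refl
  scanned-code (_ ∷ _) = refl

  rest-code : ∀ r → rest finder (map encodeSymbol r) ≡ map encodeSymbol (tailSymbols r)
  rest-code []      = refl
  rest-code (_ ∷ _) = refl

  act-code : ∀ l r q x →
    F.apply (map encodeSymbol l) (map encodeSymbol r) q (encodeAction x) ≡ code (act l r q x)
  act-code l       r q (s , a , S , e) rewrite rest-code r = refl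
  act-code l       r q (s , a , R , e) rewrite rest-code r = refl
  act-code []      r q (s , a , L , e) rewrite rest-code r = refl
  act-code (z ∷ l) r q (s , a , L , e) rewrite rest-code r = refl

  next-active : ∀ s l r q → s ≢ query →
    F.next D (code (sit s l r q)) ≡ map code (map (act l r q) (actions s (headSymbol r)))
  next-active s l r q s≢ with encodeState s Fin.≟ encodeState query
  ... | yes eq = contradiction (trans (sym (decode-encodeState s)) (cong decodeState eq)) s≢
  ... | no _ rewrite scanned-code r | decode-encodeState s | decode-encodeSymbol (headSymbol r) = begin
    map (F.apply l′ r′ q) (map encodeAction xs)   ≡⟨ map-∘ xs ⟨
    map (F.apply l′ r′ q ∘ encodeAction) xs       ≡⟨ map-cong (act-code l r q) xs ⟩
    map (code ∘ act l r q) xs                     ≡⟨ map-∘ xs ⟩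
    map code (map (act l r q) xs)                 ∎
    where
    open ≡-Reasoning
    l′ r′ : List (Sym finder)
    l′ = map encodeSymbol l
    r′ = map encodeSymbol r
    xs : List Action
    xs = actions s (headSymbol r)

  next-code : ∀ c → F.next D (code c) ≡ map code (follow c)
  next-code (sit query l r q) with D q
  ... | true  = refl
  ... | false = refl
  next-code (sit start l r q)      = next-active start l r q λ ()
  next-code (sit (guess d) l r q)  = next-active (guess d) l r q λ ()
  next-code (sit (left w) l r q)   = next-active (left w) l r q λ ()
  next-code (sit (right w) l r q)  = next-active (right w) l r q λ ()
  next-code (sit (answer b) l r q) = next-active (answer b) l r q λ ()
  next-code (sit (halt b) l r q)   = next-active (halt b) l r q λ ()

  record Reaches (c : Situation) (o : Outcome) : Set where
    constructor reaching
    field path : F.Reaches D (code c) o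

  record Bounded (c : Situation) (b : ℕ) : Set where
    constructor bounded
    field bound : F.Bounded D (code c) b

  step-follow : ∀ c {c'} → Step finder D (code c) c' → ∃ λ d → d ∈ follow c × c' ≡ code d
  step-follow c s = ∈-map⁻ code (subst (_ ∈_) (next-code c) (F.next-complete s))

  follow-step : ∀ c {d} → d ∈ follow c → Step finder D (code c) (code d)
  follow-step c i = F.next-sound (subst (_ ∈_) (sym (next-code c)) (∈-map⁺ code i))

  bounded-follow : ∀ {c b} → (∀ {d} → d ∈ follow c → Bounded d b) → Bounded c (suc b)
  bounded-follow {c} {b} all = bounded go
    where
    go : F.Bounded D (code c) (suc b)
    go _ _ done = z≤n
    go (suc t) c' (step s ss) with step-follow c s
    ... | d , i , refl = s≤s (Bounded.bound (all i) t c' ss)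

  bounded-≤ : ∀ {c a b} → a ≤ b → Bounded c a → Bounded c b
  bounded-≤ a≤b (bounded bd) = bounded λ t c' ss → ≤-trans (bd t c' ss) a≤b

  reaches-follow : ∀ {c d o} → d ∈ follow c → Reaches d o → Reaches c o
  reaches-follow {c} i (reaching (t , c' , ss , h , r)) =
    reaching (suc t , c' , step (follow-step c i) ss , h , r)

  follow-reaches : ∀ {c d ds o} → follow c ≡ d ∷ ds → Reaches c o → ∃ λ d → d ∈ follow c × Reaches d o
  follow-reaches {c} {d} eq (reaching (_ , _ , done , h , _)) =
    contradiction (follow-step c {d} (subst (d ∈_) (sym eq) (here refl))) (h (code d))
  follow-reaches {c} eq (reaching (suc t , c' , step s ss , h , r)) with step-follow c s
  ... | d , i , refl = d , i , reaching (t , c' , ss , h , r)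

  module _ {c : Situation} (stuck : follow c ≡ []) where

    stuck-halted : Halted finder D (code c)
    stuck-halted c' s with step-follow c s
    ... | d , i , _ = contradiction (subst (d ∈_) stuck i) λ ()

    stuck-bounded : Bounded c 0
    stuck-bounded = bounded λ { _ _ done → z≤n ; _ _ (step s _) → contradiction s (stuck-halted _) }

    stuck-outcome : ∀ {o} → Reaches c o → o ≡ result (state c)
    stuck-outcome (reaching (_ , _ , done , _ , r)) =
      trans (sym r) (cong result (decode-encodeState (state c)))
    stuck-outcome (reaching (_ , _ , step s _ , _)) = contradiction s (stuck-halted _)

    stuck-reaches : Reaches c (result (state c))
    stuck-reaches = reaching
      (0 , code c , done , stuck-halted , cong result (decode-encodeState (state c)))

  infix 4 _⟶⟨_⟩_
  infixr 5 _▸_ _⟫_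

  -- Deterministic runs: each situation left behind has a single successor. So both ends reach the
  -- same outcomes, and a time bound grows by the length of the run.
  data _⟶⟨_⟩_ : Situation → ℕ → Situation → Set where
    ∎   : ∀ {c} → c ⟶⟨ 0 ⟩ c
    _▸_ : ∀ {c c' c'' k} → follow c ≡ [ c' ] → c' ⟶⟨ k ⟩ c'' → c ⟶⟨ suc k ⟩ c''

  _⟫_ : ∀ {c c' c'' j k} → c ⟶⟨ j ⟩ c' → c' ⟶⟨ k ⟩ c'' → c ⟶⟨ j + k ⟩ c''
  ∎        ⟫ ys = ys
  (x ▸ xs) ⟫ ys = x ▸ (xs ⟫ ys)

  ⟶-bounded : ∀ {c c' k b} → c ⟶⟨ k ⟩ c' → Bounded c' b → Bounded c (k + b)
  ⟶-bounded ∎ bd = bd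
  ⟶-bounded {b = b} (_▸_ {k = k} x xs) bd = bounded-follow λ {d} i → only (subst (d ∈_) x i)
    where
    only : ∀ {d} → d ∈ [ _ ] → Bounded d (k + b)
    only (here refl) = ⟶-bounded xs bd

  ⟶-reaches : ∀ {c c' k o} → c ⟶⟨ k ⟩ c' → Reaches c o → Reaches c' o
  ⟶-reaches ∎ r = r
  ⟶-reaches (x ▸ xs) r with follow-reaches x r
  ... | d , i , r′ with subst (d ∈_) x i
  ...   | here refl = ⟶-reaches xs r′

  ⟶-reaches⁻ : ∀ {c c' k o} → c ⟶⟨ k ⟩ c' → Reaches c' o → Reaches c o
  ⟶-reaches⁻ ∎ r = r
  ⟶-reaches⁻ (x ▸ xs) r =
    reaches-follow (subst (_ ∈_) (sym x) (here refl)) (⟶-reaches⁻ xs r)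

  ⟶-cast : ∀ {c c' c'' j k} → j ≡ k → c' ≡ c'' → c ⟶⟨ j ⟩ c' → c ⟶⟨ k ⟩ c''
  ⟶-cast refl refl xs = xs

  at : State → List Cell → List Cell → Str → Situation
  at s ls rs q = sit s (map cell ls ++ [ edge ]) (map cell rs) q

  asking : List Cell → Str → Situation
  asking rs q = sit query [] (edge ∷ map cell rs) q

  leftward : Bool → List Cell → List Cell → Str → Situation
  leftward w []       rs q = sit (left w) [] (edge ∷ map cell rs) q
  leftward w (k ∷ ks) rs q = at (left w) ks (k ∷ rs) q

  move-left : ∀ w ls k rs a q b →
    act (map cell ls ++ [ edge ]) (a ∷ map cell rs) q (left w , cell k , L , just b)
      ≡ leftward w ls (k ∷ rs) (q ++ [ b ])
  move-left w []       k rs a q b = refl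
  move-left w (z ∷ ls) k rs a q b = refl

  sweep-left : ∀ w ks rs q →
    leftward w ks rs q ⟶⟨ suc (length ks) ⟩ asking (ks ʳ++ rs) (q ++ map (pick w ∘ proj₂) ks)
  sweep-left w []       rs q = cong (λ q′ → [ asking rs q′ ]) (sym (++-identityʳ q)) ▸ ∎
  sweep-left w (k ∷ ks) rs q =
    cong [_] (move-left w ks k rs (cell k) q (pick w (proj₂ k))) ▸
    ⟶-cast refl (cong (asking (ks ʳ++ (k ∷ rs))) (++-assoc q [ pick w (proj₂ k) ] (map (pick w ∘ proj₂) ks)))
      (sweep-left w ks (k ∷ rs) (q ++ [ pick w (proj₂ k) ]))

  -- Serves both kinds of marks: `true` over passed cells and `false` over fresh ones.
  sweep-right : ∀ s σ b →
    (∀ ls c rs q → follow (at s ls ((σ , c) ∷ rs) q) ≡ [ at s ((σ , c) ∷ ls) rs (q ++ [ b ]) ]) →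
    ∀ ts ls rs q → at s ls (paint σ ts ++ rs) q
      ⟶⟨ length ts ⟩ at s (paint σ ts ʳ++ ls) rs (q ++ replicate (length ts) b)
  sweep-right s σ b go []       ls rs q = ⟶-cast refl (cong (at s ls rs) (sym (++-identityʳ q))) ∎
  sweep-right s σ b go (c ∷ ts) ls rs q =
    go ls c (paint σ ts ++ rs) q ▸
    ⟶-cast refl (cong (at s (paint σ ts ʳ++ ((σ , c) ∷ ls)) rs) (++-assoc q [ b ] (replicate (length ts) b)))
      (sweep-right s σ b go ts ((σ , c) ∷ ls) rs (q ++ [ b ]))

  -- The tape beyond the left edge holds the pairs in order, and e in its last cell.
  module Checking (e : Pair) where

    fresh-cells : List Pair → List Cell
    fresh-cells ts = paint fresh ts ++ [ (end , e) ]

    tape : List Pair → Cell → List Pair → List Cell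
    tape ds k ts = paint passed ds ++ k ∷ fresh-cells ts

    word : Bool → List Pair → Str
    word w cols = pick w e ∷ map (pick w) (cols ʳ++ [])

    opening : ∀ rs q → asking rs q ⟶⟨ 2 ⟩ at (answer (D q)) [] rs []
    opening rs q = refl ▸ refl ▸ ∎

    to-mark : ∀ ds rs q → asking (paint passed ds ++ rs) q
      ⟶⟨ 2 + length ds ⟩ at (answer (D q)) (paint passed ds ʳ++ []) rs (replicate (length ds) true)
    to-mark ds rs q = opening (paint passed ds ++ rs) q ⟫
      sweep-right (answer (D q)) passed true (λ _ _ _ _ → refl) ds [] rs []

    from-mark : ∀ w ks ts q → at (right w) ks (fresh-cells ts) q
      ⟶⟨ length ts + (2 + length (paint fresh ts ʳ++ ks)) ⟩
      asking (ks ʳ++ fresh-cells ts)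
        (q ++ replicate (length ts) false ++ pick w e ∷ map (pick w ∘ proj₂) (paint fresh ts ʳ++ ks))
    from-mark w ks ts q = ⟶-cast refl
      (cong₂ asking (ʳ++-ʳ++ (paint fresh ts)) (begin
        ((q ++ fs) ++ [ pick w e ]) ++ zs  ≡⟨ ++-assoc (q ++ fs) [ pick w e ] zs ⟩
        (q ++ fs) ++ pick w e ∷ zs         ≡⟨ ++-assoc q fs (pick w e ∷ zs) ⟩
        q ++ fs ++ pick w e ∷ zs           ≡∎))
      (sweep-right (right w) fresh false (λ _ _ _ _ → refl) ts ks [ (end , e) ] q ⟫
       cong [_] (move-left w (paint fresh ts ʳ++ ks) (end , e) [] (cell (end , e)) (q ++ fs) (pick w e)) ▸
       sweep-left w (paint fresh ts ʳ++ ks) [ (end , e) ] ((q ++ fs) ++ [ pick w e ]))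
      where
      open ≡-Reasoning renaming (_∎ to _≡∎)
      fs zs : Str
      fs = replicate (length ts) false
      zs = map (pick w ∘ proj₂) (paint fresh ts ʳ++ ks)

    -- There are `m` steps in each direction and four more: the answer of the oracle, leaving
    -- `edge`, turning at the `end` cell, and entering the query state.
    cycle-length : ℕ → ℕ
    cycle-length m = 4 + 2 * m

    -- From one query to the next: the answer is carried to the cell `k`, which becomes `k′`. With
    -- `b = false` the same bit of the second string is asked for, with `b = true` the next bit of
    -- the first one.
    cycle : ∀ w ds k k′ ts q b →
      (∀ ls rs q′ → follow (at (answer (D q)) ls (k ∷ rs) q′) ≡ [ at (right w) (k′ ∷ ls) rs (q′ ++ [ b ]) ]) →
      asking (tape ds k ts) q ⟶⟨ cycle-length (length ds + suc (length ts)) ⟩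
      asking (tape ds k′ ts)
        ((replicate (length ds) true ++ b ∷ replicate (length ts) false) ++ word w (ds ++ proj₂ k′ ∷ ts))
    cycle w ds k k′ ts q b go = ⟶-cast count
      (cong₂ asking (ʳ++-ʳ++ (paint passed ds)) written≡)
      (to-mark ds (k ∷ fresh-cells ts) q ⟫
       go (paint passed ds ʳ++ []) (fresh-cells ts) (replicate (length ds) true) ▸
       from-mark w ks ts (replicate (length ds) true ++ [ b ]))
      where
      open ≡-Reasoning renaming (_∎ to _≡∎)
      ks : List Cell
      ks = k′ ∷ (paint passed ds ʳ++ [])
      ds′ fs : Str
      ds′ = replicate (length ds) true
      fs = replicate (length ts) false
      pairs≡ : map proj₂ (paint fresh ts ʳ++ ks) ≡ (ds ++ proj₂ k′ ∷ ts) ʳ++ []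
      pairs≡ = begin
        map proj₂ (paint fresh ts ʳ++ ks)               ≡⟨ map-ʳ++ proj₂ (paint fresh ts) ⟩
        map proj₂ (paint fresh ts) ʳ++ map proj₂ ks     ≡⟨ cong₂ _ʳ++_ (forget fresh ts) (cong (proj₂ k′ ∷_)
          (trans (map-ʳ++ proj₂ (paint passed ds)) (cong (_ʳ++ []) (forget passed ds)))) ⟩
        ts ʳ++ (proj₂ k′ ∷ (ds ʳ++ []))                    ≡⟨ ++-ʳ++ ds ⟨
        (ds ++ proj₂ k′ ∷ ts) ʳ++ []                       ≡∎
        where
        forget : ∀ (σ : Status) (cs : List Pair) → map proj₂ (paint σ cs) ≡ cs
        forget σ cs = trans (sym (map-∘ cs)) (map-id cs)
      written≡ : (ds′ ++ [ b ]) ++ fs ++ pick w e ∷ map (pick w ∘ proj₂) (paint fresh ts ʳ++ ks)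
        ≡ (ds′ ++ b ∷ fs) ++ word w (ds ++ proj₂ k′ ∷ ts)
      written≡ = begin
        (ds′ ++ [ b ]) ++ fs ++ pick w e ∷ map (pick w ∘ proj₂) (paint fresh ts ʳ++ ks)
          ≡⟨ cong (λ zs → (ds′ ++ [ b ]) ++ fs ++ pick w e ∷ zs)
               (trans (map-∘ (paint fresh ts ʳ++ ks)) (cong (map (pick w)) pairs≡)) ⟩
        (ds′ ++ [ b ]) ++ fs ++ word w (ds ++ proj₂ k′ ∷ ts)
          ≡⟨ ++-assoc ds′ [ b ] (fs ++ word w (ds ++ proj₂ k′ ∷ ts)) ⟩
        ds′ ++ (b ∷ fs) ++ word w (ds ++ proj₂ k′ ∷ ts)
          ≡⟨ ++-assoc ds′ (b ∷ fs) (word w (ds ++ proj₂ k′ ∷ ts)) ⟨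
        (ds′ ++ b ∷ fs) ++ word w (ds ++ proj₂ k′ ∷ ts) ≡∎
      count : 2 + length ds + suc (length ts + (2 + length (paint fresh ts ʳ++ ks)))
        ≡ cycle-length (length ds + suc (length ts))
      count = trans
        (cong (λ n → 2 + length ds + suc (length ts + (2 + n)))
          (trans (length-paint fresh ts ks) (cong (λ n → length ts + suc n)
            (trans (length-paint passed ds []) (+-identityʳ (length ds))))))
        (arithmetic (length ds) (length ts))
        where
        arithmetic : ∀ a b → 2 + a + suc (b + (2 + (b + suc a))) ≡ 4 + 2 * (a + suc b)
        arithmetic = solve-∀

    first-asked : List Pair → List Pair → Situation
    first-asked ds ts = asking (paint passed ds ++ fresh-cells ts)
      (marks (length ds) (length ts) ++ word false (ds ++ ts))

    second-asked : List Pair → Bool → Pair → List Pair → Situation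
    second-asked ds b c ts = asking (tape ds (seen b , c) ts)
      (marks (length ds) (suc (length ts)) ++ word true (ds ++ c ∷ ts))

    reading : Bool → List Pair → ℕ → ℕ → Bool
    reading w cols i j = D (marks i j ++ word w cols)

    ask-second : ∀ ds c ts → first-asked ds (c ∷ ts)
      ⟶⟨ cycle-length (length (ds ++ c ∷ ts)) ⟩
      second-asked ds (reading false (ds ++ c ∷ ts) (length ds) (suc (length ts))) c ts
    ask-second ds c ts = ⟶-cast (cong cycle-length (sym (length-++ ds))) refl
      (cycle true ds (fresh , c) (seen _ , c) ts
        (marks (length ds) (suc (length ts)) ++ word false (ds ++ c ∷ ts)) false λ _ _ _ → refl)

    ask-next : ∀ ds b c ts → reading true (ds ++ c ∷ ts) (length ds) (suc (length ts)) ≡ b →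
      second-asked ds b c ts ⟶⟨ cycle-length (length (ds ++ c ∷ ts)) ⟩ first-asked (ds ++ [ c ]) ts
    ask-next ds b c ts refl = ⟶-cast (cong cycle-length (sym (length-++ ds)))
      (cong₂ asking
        (trans (sym (++-assoc (paint passed ds) [ (passed , c) ] (fresh-cells ts)))
          (cong (_++ fresh-cells ts) (sym (map-++ (passed ,_) ds [ c ]))))
        (cong₂ _++_ (mark-one ds) (cong (word false) (sym (++-assoc ds [ c ] ts)))))
      (cycle false ds (seen b , c) (passed , c) ts q true confirmed)
      where
      q : Str
      q = marks (length ds) (suc (length ts)) ++ word true (ds ++ c ∷ ts)
      confirmed : ∀ ls rs q′ → follow (at (answer (D q)) ls ((seen (D q) , c) ∷ rs) q′)
        ≡ [ at (right false) ((passed , c) ∷ ls) rs (q′ ++ [ true ]) ]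
      confirmed ls rs q′ with D q
      ... | true  = refl
      ... | false = refl
      mark-one : ∀ xs → replicate (length xs) true ++ true ∷ replicate (length ts) false
        ≡ marks (length (xs ++ [ c ])) (length ts)
      mark-one []       = refl
      mark-one (x ∷ xs) = cong (true ∷_) (mark-one xs)

    module Mismatch {ds b c ts}
      (≢b : reading true (ds ++ c ∷ ts) (length ds) (suc (length ts)) ≢ b) where

      answered : Bool
      answered = reading true (ds ++ c ∷ ts) (length ds) (suc (length ts))

      dead-end : Situation
      dead-end = at (answer answered) (paint passed ds ʳ++ []) ((seen b , c) ∷ fresh-cells ts)
        (replicate (length ds) true)

      to-dead-end : second-asked ds b c ts ⟶⟨ 2 + length ds ⟩ dead-end
      to-dead-end = to-mark ds ((seen b , c) ∷ fresh-cells ts) _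

      is-dead-end : follow dead-end ≡ []
      is-dead-end = go answered b ≢b
        where
        go : ∀ a b′ → a ≢ b′ →
          follow (at (answer a) (paint passed ds ʳ++ []) ((seen b′ , c) ∷ fresh-cells ts) (replicate (length ds) true)) ≡ []
        go true  true  a≢ = contradiction refl a≢
        go false false a≢ = contradiction refl a≢
        go true  false a≢ = refl
        go false true  a≢ = refl

    module Finish (ds : List Pair) where

      answered : Bool
      answered = D (marks (length ds) 0 ++ word false (ds ++ []))

      goal : Situation
      goal = sit (halt answered) (map cell (paint passed ds ʳ++ []) ++ [ edge ]) (map cell (fresh-cells []))
        (replicate (length ds) true)

      to-goal : first-asked ds [] ⟶⟨ 2 + length ds + 1 ⟩ goal
      to-goal = to-mark ds (fresh-cells []) _ ⟫ refl ▸ ∎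

    AgreeFrom : ℕ → List Pair → Set
    AgreeFrom n cols = ∀ i j → n ≤ i → i + suc j ≡ length cols →
      reading false cols i (suc j) ≡ reading true cols i (suc j)

    labelled : List Pair → Outcome
    labelled cols = verdict (reading false cols (length cols) 0)

    length-all : ∀ (ds : List Pair) → length (ds ++ []) ≡ length ds
    length-all ds = trans (length-++ ds) (+-identityʳ (length ds))

    length-snoc : ∀ (ds : List Pair) c → length (ds ++ [ c ]) ≡ suc (length ds)
    length-snoc ds c = trans (length-++ ds) (+-comm (length ds) 1)

    goal-labelled : ∀ ds → result (state (Finish.goal ds)) ≡ labelled (ds ++ [])
    goal-labelled ds = cong (λ n → verdict (reading false (ds ++ []) n 0)) (sym (length-all ds))

    -- Induction on the unchecked cells `ts`: a mismatch ends in `dead-end` with outcome `que`, so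
    -- any other outcome forces the remaining bits to agree and is then read off as the label.
    checked : ∀ ds ts cols → ds ++ ts ≡ cols → ∀ {o} → o ≢ que → Reaches (first-asked ds ts) o →
      AgreeFrom (length ds) cols × o ≡ labelled cols
    checked ds [] cols refl o≢ r =
      (λ i j ds≤i eq →
        contradiction (subst (_≤ i) (trans (sym (length-all ds)) (sym eq)) ds≤i) (m+1+n≰m i)) ,
      trans (stuck-outcome {Finish.goal ds} refl (⟶-reaches (Finish.to-goal ds) r)) (goal-labelled ds)
    checked ds (c ∷ ts) cols refl {o} o≢ r
      with reading true (ds ++ c ∷ ts) (length ds) (suc (length ts))
           Bool.≟ reading false (ds ++ c ∷ ts) (length ds) (suc (length ts))
    ... | no ≢b = contradiction
          (stuck-outcome is-dead-end (⟶-reaches to-dead-end (⟶-reaches (ask-second ds c ts) r))) o≢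
      where open Mismatch {ds} {c = c} {ts} ≢b
    ... | yes ≡b with checked (ds ++ [ c ]) ts (ds ++ c ∷ ts) (++-assoc ds [ c ] ts) o≢
          (⟶-reaches (ask-next ds _ c ts ≡b) (⟶-reaches (ask-second ds c ts) r))
    ...   | agree , label≡ = agree′ , label≡
      where
      agree′ : AgreeFrom (length ds) (ds ++ c ∷ ts)
      agree′ i j ds≤i eq with m≤n⇒m<n∨m≡n ds≤i
      ... | inj₁ ds<i = agree i j (subst (_≤ i) (sym (length-snoc ds c)) ds<i) eq
      ... | inj₂ refl = subst
        (λ k → reading false (ds ++ c ∷ ts) (length ds) k ≡ reading true (ds ++ c ∷ ts) (length ds) k)
        (sym (+-cancelˡ-≡ (length ds) _ _ (trans eq (length-++ ds)))) (sym ≡b)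

    accepted : ∀ ds ts cols → ds ++ ts ≡ cols → AgreeFrom (length ds) cols →
      Reaches (first-asked ds ts) (labelled cols)
    accepted ds [] cols refl agree = ⟶-reaches⁻ (Finish.to-goal ds)
      (subst (Reaches (Finish.goal ds)) (goal-labelled ds) (stuck-reaches {Finish.goal ds} refl))
    accepted ds (c ∷ ts) cols refl agree =
      ⟶-reaches⁻ (ask-second ds c ts) (⟶-reaches⁻ (ask-next ds _ c ts
        (sym (agree (length ds) (length ts) ≤-refl (sym (length-++ ds)))))
        (accepted (ds ++ [ c ]) ts (ds ++ c ∷ ts) (++-assoc ds [ c ] ts)
          λ i j ds<i → agree i j (≤-trans (n≤1+n (length ds)) (subst (_≤ i) (length-snoc ds c) ds<i))))

    -- Two cycles for every unchecked cell; the one in excess pays for the final answer or for the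
    -- way to a dead end.
    checking-bounded : ∀ ds ts cols → ds ++ ts ≡ cols →
      Bounded (first-asked ds ts) (suc (2 * length ts) * cycle-length (length cols))
    checking-bounded ds [] cols refl = bounded-≤ fits
      (⟶-bounded (Finish.to-goal ds) (stuck-bounded {Finish.goal ds} refl))
      where
      fits : 2 + length ds + 1 + 0 ≤ 1 * cycle-length (length (ds ++ []))
      fits = subst (λ n → 2 + length ds + 1 + 0 ≤ 1 * cycle-length n) (sym (length-all ds))
        (≤-trans (m≤m+n _ (1 + length ds)) (≤-reflexive (arithmetic (length ds))))
        where
        arithmetic : ∀ n → 2 + n + 1 + 0 + (1 + n) ≡ 1 * (4 + 2 * n)
        arithmetic = solve-∀
    checking-bounded ds (c ∷ ts) cols refl
      with reading true (ds ++ c ∷ ts) (length ds) (suc (length ts))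
           Bool.≟ reading false (ds ++ c ∷ ts) (length ds) (suc (length ts))
    ... | no ≢b = bounded-≤ fits
        (⟶-bounded (ask-second ds c ts) (⟶-bounded to-dead-end (stuck-bounded is-dead-end)))
      where
      open Mismatch {ds} {c = c} {ts} ≢b
      W : ℕ
      W = cycle-length (length (ds ++ c ∷ ts))
      fits : W + (2 + length ds + 0) ≤ suc (2 * suc (length ts)) * W
      fits = +-monoʳ-≤ W (≤-trans (subst (λ n → 2 + length ds + 0 ≤ cycle-length n) (sym (length-++ ds))
          (≤-trans (m≤m+n _ (4 + length ds + 2 * length ts)) (≤-reflexive (arithmetic (length ds) (length ts)))))
        (m≤m+n W _))
        where
        arithmetic : ∀ a b → 2 + a + 0 + (4 + a + 2 * b) ≡ 4 + 2 * (a + suc b)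
        arithmetic = solve-∀
    ... | yes ≡b = bounded-≤ (≤-reflexive (arithmetic (cycle-length (length (ds ++ c ∷ ts))) (length ts)))
        (⟶-bounded (ask-second ds c ts) (⟶-bounded (ask-next ds _ c ts ≡b)
          (checking-bounded (ds ++ [ c ]) ts (ds ++ c ∷ ts) (++-assoc ds [ c ] ts))))
      where
      arithmetic : ∀ w n → w + (w + suc (2 * n) * w) ≡ suc (2 * suc n) * w
      arithmetic = solve-∀

  -- Guessing two different strings

  guessing : Bool → List Pair → Str → Str → Situation
  guessing d ls x q = sit (guess d) (map cell (paint fresh ls) ++ [ edge ]) (map bit x) q

  guessed : List Pair → Pair → Str → Situation
  guessed ls e q = leftward false (paint fresh ls) [ (end , e) ] (q ++ [ pick false e ])

  -- The first input symbol gives way to `edge`. The empty input behaves like one of length 1, in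
  -- accordance with `pred`.
  begun : ∀ x → sit start [] (map bit x) [] ⟶⟨ 1 ⟩ guessing false [] (drop 1 x) []
  begun []      = refl ▸ ∎
  begun (_ ∷ x) = refl ▸ ∎

  choose-cell : ∀ {d ls b x q c} → c ∈ pairs →
    guessing (d ∨ differs c) (c ∷ ls) x (q ++ [ false ]) ∈ follow (guessing d ls (b ∷ x) q)
  choose-cell {d} {ls} {b} {x} {q} i =
    ∈-map⁺ (act (map cell (paint fresh ls) ++ [ edge ]) (map bit (b ∷ x)) q) (∈-map⁺ (guess-cell d) i)

  chosen-cell : ∀ {d ls b x q s} → s ∈ follow (guessing d ls (b ∷ x) q) →
    ∃ λ c → s ≡ guessing (d ∨ differs c) (c ∷ ls) x (q ++ [ false ])
  chosen-cell {d} {ls} {b} {x} {q} i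
    with ∈-map⁻ (act (map cell (paint fresh ls) ++ [ edge ]) (map bit (b ∷ x)) q) i
  ... | a , j , refl with ∈-map⁻ (guess-cell d) j
  ...   | c , _ , refl = c , refl

  close-cell : ∀ ls q c →
    act (map cell (paint fresh ls) ++ [ edge ]) [] q (guess-end c)
      ≡ guessed ls c q
  close-cell []       q c = refl
  close-cell (l ∷ ls) q c = refl

  choose-end : ∀ {d ls q c} → c ∈ ends d → guessed ls c q ∈ follow (guessing d ls [] q)
  choose-end {d} {ls} {q} {c} i = subst (_∈ follow (guessing d ls [] q)) (close-cell ls q c)
    (∈-map⁺ (act (map cell (paint fresh ls) ++ [ edge ]) [] q) (∈-map⁺ guess-end i))

  chosen-end : ∀ {d ls q s} → s ∈ follow (guessing d ls [] q) →
    ∃ λ c → c ∈ ends d × s ≡ guessed ls c q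
  chosen-end {d} {ls} {q} i with ∈-map⁻ (act (map cell (paint fresh ls) ++ [ edge ]) [] q) i
  ... | a , j , refl with ∈-map⁻ guess-end j
  ...   | c , k , refl = c , k , close-cell ls q c

  extend-false : ∀ ls e q n → guessed ls e ((q ++ [ false ]) ++ replicate n false)
    ≡ guessed ls e (q ++ replicate (suc n) false)
  extend-false ls e q n = cong (guessed ls e) (++-assoc q [ false ] (replicate n false))

  guess-outcome : ∀ x d ls q {o} → Reaches (guessing d ls x q) o → ∃₂ λ cs e →
    length cs ≡ length x × e ∈ ends (flag d cs)
      × Reaches (guessed (cs ʳ++ ls) e (q ++ replicate (length x) false)) o
  guess-outcome [] d ls q r with guess-first
    where
    guess-first : ∃ λ s → s ∈ follow (guessing d ls [] q) × Reaches s _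
    guess-first = go d r
      where
      -- The list `ends d` is visibly nonempty only after a case split on `d`.
      go : ∀ d → Reaches (guessing d ls [] q) _ → ∃ λ s → s ∈ follow (guessing d ls [] q) × Reaches s _
      go true  r = follow-reaches refl r
      go false r = follow-reaches refl r
  ... | s , i , r′ with chosen-end {d} i
  ...   | c , k , refl = [] , c , refl , k , subst (λ q′ → Reaches (guessed ls c q′) _) (sym (++-identityʳ q)) r′
  guess-outcome (b ∷ x) d ls q r with follow-reaches refl r
  ... | s , i , r′ with chosen-cell {d} {ls} {b} {x} {q} i
  ...   | c , refl with guess-outcome x (d ∨ differs c) (c ∷ ls) (q ++ [ false ]) r′
  ...     | cs , e , len , k , r″ = c ∷ cs , e , cong suc len , k ,
    subst (λ s → Reaches s _) (extend-false (cs ʳ++ (c ∷ ls)) e q (length x)) r″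

  guess-reaches : ∀ x d ls q cs e {o} → length cs ≡ length x → e ∈ ends (flag d cs) →
    Reaches (guessed (cs ʳ++ ls) e (q ++ replicate (length x) false)) o → Reaches (guessing d ls x q) o
  guess-reaches [] d ls q [] e _ k r = reaches-follow (choose-end {d} {ls} {q} k)
    (subst (λ q′ → Reaches (guessed ls e q′) _) (++-identityʳ q) r)
  guess-reaches (b ∷ x) d ls q (c ∷ cs) e len k r =
    reaches-follow (choose-cell {d} {ls} {b} {x} {q} (∈-pairs c))
      (guess-reaches x (d ∨ differs c) (c ∷ ls) (q ++ [ false ]) cs e (suc-injective len) k
        (subst (λ s → Reaches s _) (sym (extend-false (cs ʳ++ (c ∷ ls)) e q (length x))) r))

  guess-bounded : ∀ x d ls q b →
    (∀ cs e → length cs ≡ length x →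
      Bounded (guessed (cs ʳ++ ls) e (q ++ replicate (length x) false)) b) →
    Bounded (guessing d ls x q) (suc (length x) + b)
  guess-bounded [] d ls q b all = bounded-follow λ i → only (chosen-end {d} {ls} {q} i)
    where
    only : ∀ {s} → (∃ λ c → c ∈ ends d × s ≡ guessed ls c q) → Bounded s b
    only (c , _ , refl) = subst (λ q′ → Bounded (guessed ls c q′) b) (++-identityʳ q) (all [] c refl)
  guess-bounded (a ∷ x) d ls q b all = bounded-follow λ i → only (chosen-cell {d} {ls} {a} {x} {q} i)
    where
    only : ∀ {s} → (∃ λ c → s ≡ guessing (d ∨ differs c) (c ∷ ls) x (q ++ [ false ])) →
      Bounded s (suc (length x) + b)
    only (c , refl) = guess-bounded x (d ∨ differs c) (c ∷ ls) (q ++ [ false ]) b λ cs e len →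
      subst (λ s → Bounded s b) (sym (extend-false (cs ʳ++ (c ∷ ls)) e q (length x)))
        (all (c ∷ cs) e (cong suc len))

  module _ (cs : List Pair) (e : Pair) where
    open Checking e

    to-first : guessed (cs ʳ++ []) e (replicate (length cs) false)
      ⟶⟨ suc (length cs) ⟩ first-asked [] cs
    to-first = ⟶-cast
      (cong suc (trans (length-map {B = Cell} (fresh ,_) (cs ʳ++ [])) (length-reverse cs)))
      (cong₂ asking
        (trans (cong (_ʳ++ [ (end , e) ]) (map-ʳ++ (fresh ,_) cs)) (ʳ++-ʳ++ (paint fresh cs)))
        (trans (++-assoc (replicate (length cs) false) [ pick false e ] _)
          (cong (λ zs → replicate (length cs) false ++ pick false e ∷ zs)
            (sym (map-∘ (cs ʳ++ []))))))
      (sweep-left false (paint fresh (cs ʳ++ [])) [ (end , e) ] (replicate (length cs) false ++ [ pick false e ]))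

    collide : e ∈ ends (flag false cs) → AgreeFrom 0 cs →
      ∃ λ (κ : Collision D (length cs)) → verdict (label κ) ≡ labelled cs
    collide i agree = record
      { left = word false cs ; right = word true cs
      ; length-left = length-word false ; length-right = length-word true
      ; distinct = distinct ; agree = λ i j → agree i j z≤n } , refl
      where
      length-word : ∀ w → length (word w cs) ≡ suc (length cs)
      length-word w = cong suc (trans (length-map (pick w) (cs ʳ++ []))
        (length-reverse cs))
      distinct : word false cs ≢ word true cs
      distinct eq with ∷-injective eq
      -- Equal tails leave the flag `false`, and then the last pair was chosen with unequal bits.
      ... | heads , tails = ends-false (subst (λ d → e ∈ ends d) (flag-equal cs tails′) i) heads
        where
        tails′ : map (pick false) cs ≡ map (pick true) cs
        tails′ = reverse-injective (trans (sym (map-ʳ++ (pick false) cs)) (trans tails (map-ʳ++ (pick true) cs)))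

  -- The pairs of the tails, in reverse order, are a legal guess: if none of them differs, the first
  -- bits must, since the strings of a collision are distinct.
  guesses : ∀ {m} (κ : Collision D m) → ∃₂ λ cs e → length cs ≡ m × e ∈ ends (flag false cs) ×
    (let open Checking e in word false cs ≡ Collision.left κ × word true cs ≡ Collision.right κ)
  guesses record { left = a ∷ u ; right = b ∷ v ; length-left = lu ; length-right = lv ; distinct = uv }
    with pair-up u v (suc-injective (trans lu (sym lv)))
  ... | zs , refl , refl = reverse zs , (a , b) ,
    trans (length-reverse zs) (trans (sym (length-map (pick false) zs)) (suc-injective lu)) ,
    ∈-ends _ (a , b) (λ unflagged → differs-≢ (a , b) λ a≡b → uv (cong₂ _∷_ a≡b
      (reverse-injective (trans (sym (reverse-map (pick false) zs))
        (trans (proj₂ (flag-false false (reverse zs) unflagged)) (reverse-map (pick true) zs)))))) ,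
    cong (λ ws → a ∷ map (pick false) ws) (reverse-involutive zs) ,
    cong (λ ws → b ∷ map (pick true) ws) (reverse-involutive zs)

  initial-code : ∀ x → code (sit start [] (map bit x) []) ≡ initial finder x
  initial-code x = cong (λ r → cfg (encodeState start) [] r [])
    (trans (sym (map-∘ x)) (map-cong (λ { false → refl ; true → refl }) x))

  from-initial : ∀ {x o} → Produces finder D x o → Reaches (sit start [] (map bit x) []) o
  from-initial {x} {o} p = reaching (subst (λ c → F.Reaches D c o) (sym (initial-code x)) p)

  length-rest : ∀ (x : Str) → length (drop 1 x) ≡ pred (length x)
  length-rest []      = refl
  length-rest (_ ∷ x) = refl

  finder-sound : ∀ x {o} → o ≢ que → Produces finder D x o →
    ∃ λ (κ : Collision D (pred (length x))) → o ≡ verdict (label κ)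
  finder-sound x {o} o≢ p
    with guess-outcome (drop 1 x) false [] [] (⟶-reaches (begun x) (from-initial {x} p))
  ... | cs , e , len , i , r with Checking.checked e [] cs cs refl o≢
        (⟶-reaches (to-first cs e) (subst (λ n → Reaches (guessed (cs ʳ++ []) e (replicate n false)) o) (sym len) r))
  ...   | agree , o≡ with collide cs e i agree
  ...     | κ , label≡ = subst (λ m → ∃ λ (κ : Collision D m) → o ≡ verdict (label κ))
    (trans len (length-rest x)) (κ , trans o≡ (sym label≡))

  finder-complete : ∀ x (κ : Collision D (pred (length x))) → Produces finder D x (verdict (label κ))
  finder-complete x κ with guesses κ
  ... | cs , e , len , i , left≡ , right≡ = subst (λ c → F.Reaches D c (verdict (label κ))) (initial-code x)
    (Reaches.path (⟶-reaches⁻ (begun x) (guess-reaches (drop 1 x) false [] [] cs e len′ i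
      (subst (λ n → Reaches (guessed (cs ʳ++ []) e (replicate n false)) _) len′
        (⟶-reaches⁻ (to-first cs e) (subst (Reaches (first-asked [] cs)) label≡
          (accepted [] cs cs refl agree′)))))))
    where
    open Checking e
    len′ : length cs ≡ length (drop 1 x)
    len′ = trans len (sym (length-rest x))
    label≡ : labelled cs ≡ verdict (label κ)
    label≡ = cong₂ (λ m z → verdict (D (marks m 0 ++ z))) len left≡
    agree′ : AgreeFrom 0 cs
    agree′ i j _ eq = trans (cong (λ z → D (marks i (suc j) ++ z)) left≡)
      (trans (Collision.agree κ i j (trans eq len)) (sym (cong (λ z → D (marks i (suc j) ++ z)) right≡)))

  finder-bounded : ∀ x t c' → Steps finder D (initial finder x) t c' → t ≤ 32 * length x ^ 2 + 32
  finder-bounded x t c' ss = ≤-trans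
    (Bounded.bound total t c' (subst (λ c → Steps finder D c t c') (sym (initial-code x)) ss)) fits
    where
    m n : ℕ
    m = length (drop 1 x)
    n = length x
    total : Bounded (sit start [] (map bit x) [])
      (1 + (suc m + (suc m + suc (2 * m) * (4 + 2 * m))))
    total = ⟶-bounded (begun x) (guess-bounded (drop 1 x) false [] [] _ λ cs e len →
      subst (λ k → Bounded (guessed (cs ʳ++ []) e (replicate k false)) (suc k + suc (2 * k) * (4 + 2 * k))) len
        (⟶-bounded (to-first cs e) (Checking.checking-bounded e [] cs cs refl)))
    m≤n : m ≤ n
    m≤n = ≤-trans (≤-reflexive (length-rest x)) (pred[n]≤n)
    n≤n*n : ∀ n → n ≤ n * n
    n≤n*n zero    = z≤n
    n≤n*n (suc n) = m≤m*n (suc n) (suc n)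
    -- The count is a quadratic polynomial in `m`; 32 is a generous choice for the one constant that
    -- is both factor and summand in `PolyTime`.
    fits : 1 + (suc m + (suc m + suc (2 * m) * (4 + 2 * m))) ≤ 32 * n ^ 2 + 32
    fits = begin
      1 + (suc m + (suc m + suc (2 * m) * (4 + 2 * m)))  ≡⟨ expand m ⟩
      4 * (m * m) + 12 * m + 7       ≤⟨ +-monoˡ-≤ 7 (+-monoʳ-≤ (4 * (m * m)) (*-monoʳ-≤ 12 (n≤n*n m))) ⟩
      4 * (m * m) + 12 * (m * m) + 7 ≤⟨ m≤m+n _ (16 * (m * m) + 25) ⟩
      4 * (m * m) + 12 * (m * m) + 7 + (16 * (m * m) + 25) ≡⟨ collect (m * m) ⟩
      32 * (m * m) + 32              ≤⟨ +-monoˡ-≤ 32 (*-monoʳ-≤ 32 (*-mono-≤ m≤n m≤n)) ⟩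
      32 * (n * n) + 32              ≡⟨ cong (λ k → 32 * (n * k) + 32) (*-identityʳ n) ⟨
      32 * n ^ 2 + 32                ∎ᵣ
      where
      open ≤-Reasoning renaming (_∎ to _∎ᵣ)
      expand : ∀ m → 1 + (suc m + (suc m + suc (2 * m) * (4 + 2 * m))) ≡ 4 * (m * m) + 12 * m + 7
      expand = solve-∀
      collect : ∀ k → 4 * k + 12 * k + 7 + (16 * k + 25) ≡ 32 * k + 32
      collect = solve-∀

-- The separation

finderNPTM : NPTM
finderNPTM = record { machine = finder ; poly = 32 , 2 , λ D → Finder.finder-bounded D }

finder-overproductive : RobustlyOverproductive finder
finder-overproductive D x only-que
  with label (collision D (pred (length x))) | Finder.finder-complete D x (collision D (pred (length x)))
... | true  | p = contradiction (Equivalence.to (only-que acc) p) λ ()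
... | false | p = contradiction (Equivalence.to (only-que rej) p) λ ()

Y-labels : ∀ {m} (κ κ′ : Collision Y m) → label κ ≡ label κ′
Y-labels {m} κ κ′ = let (_ , p) = Y-promise m in trans (p κ) (sym (p κ′))

verdict-injective : ∀ {a b} → verdict a ≡ verdict b → a ≡ b
verdict-injective {false} {false} _ = refl
verdict-injective {true}  {true}  _ = refl

finder-underproductive : Underproductive finder Y
finder-underproductive x (p , q)
  with Finder.finder-sound Y x (λ ()) p | Finder.finder-sound Y x (λ ()) q
... | κ , acc≡ | κ′ , rej≡ =
  contradiction (trans acc≡ (trans (cong verdict (Y-labels κ κ′)) (sym rej≡))) λ ()

finder-decides : Decides finder Y X
finder-decides x = mk⇔
  (λ X≡ → subst (Produces finder Y x) (cong verdict X≡) (Finder.finder-complete Y x (collision Y (pred (length x)))))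
  λ p → let (κ , acc≡) = Finder.finder-sound Y x (λ ()) p in
    trans (Y-labels (collision Y (pred (length x))) κ) (verdict-injective (sym acc≡))

theorem4p7 : Σ Lang λ X → Σ Lang λ Y → (X ≤O Y) × ¬ (X ≤U Y)
theorem4p7 = X , Y ,
  (finderNPTM , finder-overproductive , finder-overproductive Y , finder-underproductive , finder-decides) ,
  X≰Y
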